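{- Let $\Delta$ be an environment of the Büchi type system and $\eta:\mathfrak X\to\mathcal M_{\le\omega}$ with $\eta\models_{\mathfrak A}\Delta$. For every derivable judgement $\Delta\vdash_{\mathfrak A} e\ \&\ (\mathcal U,\mathcal V(\mathfrak X))$ and every trace $w$: if $e\downarrow w$ then $w\in\gamma_*(\mathcal U)$, and if $e\uparrow w$ then $w\in\gamma_{\le\omega}(\mathcal V(\eta))$.
   Context: Language and semantics. Fix a finite alphabet $\Sigma$ of events; $\Sigma^{\le\omega}=\Sigma^*\cup\Sigma^\omega$; $w\cdot u=wu$ if $w$ is finite and $w\cdot u=w$ if $w$ is infinite, extended pointwise to languages; for $A\subseteq\Sigma^*$, $A^*$ is the Kleene star and $A^\omega$ the set of words $w_0w_1w_2\cdots$ with $w_i\in A$; $CD^\omega$ means $C\cdot D^\omega$. Expressions: $e::=o(a)\mid f\mid e_1;e_2\mid e_1?e_2$ ($a\in\Sigma$, $f$ a procedure name). A fixed program consists of a finite set $\mathcal F$ of procedure names and a defining expression $e_f$ for each $f\in\mathcal F$ using only names from $\mathcal F$. Let $\checkmark\notin\Sigma$; $e\Downarrow w$ and $e\Uparrow w$ ($w\in(\Sigma\uplus\{\checkmark\})^*$) are the least relations with: $o(a)\Downarrow a$; $o(a)\Uparrow a$; $e\Uparrow\epsilon$; $e_f\Downarrow w\Rightarrow f\Downarrow w$; $e_f\Uparrow w\Rightarrow f\Uparrow\checkmark w$; $e_1\Downarrow w,e_2\Downarrow u\Rightarrow e_1;e_2\Downarrow wu$; $e_1\Downarrow w,e_2\Uparrow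 u\Rightarrow e_1;e_2\Uparrow wu$; $e_1\Uparrow w\Rightarrow e_1;e_2\Uparrow w$; $e_i\Downarrow w\Rightarrow e_1?e_2\Downarrow w$ and $e_i\Uparrow w\Rightarrow e_1?e_2\Uparrow w$ ($i=1,2$). $\theta$ deletes all $\checkmark$. $e\downarrow w$ iff $w=\theta(w')$ for a finite $w'$ with $e\Downarrow w'$; $e\uparrow w$ iff $w=\theta(w')$ for an infinite $w'\in(\Sigma\uplus\{\checkmark\})^\omega$ all of whose finite prefixes $u$ satisfy $e\Uparrow u$. Abstraction. Fix an extended Büchi automaton $\mathfrak A=(Q,\Sigma,\delta,q_0,F)$. For $w\in\Sigma^*$, $p\overset{w}{\leadsto}q$ means $q$ is reachable from $p$ reading $w$; $p\overset{w}{\leadsto}_Fq$ means $w=uv$, $p\overset{u}{\leadsto}q''\overset{v}{\leadsto}q$ for some $q''\in F$. For $w,u\in\Sigma^+$, $w\sim u$ iff for all $p,q$ both relations agree on $w$ and $u$. $\mathcal Q=\Sigma^+/{\sim}\uplus\{\{\epsilon\}\}$, a monoid under class concatenation. $\mathcal C=\{(C,D)\in\mathcal Q^2\mid CD=C,DD=D\}$; $\mathfrak f(V)=\{(C,D)\in\mathcal C\mid CD^\omega\cap V\ne\emptyset\}$; $\mathfrak g(\mathcal V)=\bigcup_{(C,D)\in\mathcal V}CD^\omega$; $\mathfrak c(\mathcal V)=\bigcup_{n\ge1}(\mathfrak f\circ\mathfrak g)^n(\mathcal V)$; $\mathcal M_{\le\omega}=\{\mathfrak c(\mathfrak f(V))\mid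 V\subseteq\Sigma^{\le\omega}\}$; $\mathcal M_*=\mathcal P(\mathcal Q)$. $\alpha_*(U)=\{C\in\mathcal Q\mid C\cap U\ne\emptyset\}$, $\alpha_{\le\omega}(V)=\mathfrak c(\mathfrak f(V))$, $\gamma_*(\mathcal U)=\bigcup_{C\in\mathcal U}C$, $\gamma_{\le\omega}=\mathfrak g$. Abstract operations: $\mathcal U\cdot\mathcal U'=\{CC'\mid C\in\mathcal U,C'\in\mathcal U'\}$; $\mathcal U\cdot\mathcal V=\{(AC,D)\mid A\in\mathcal U,(C,D)\in\mathcal V\}$ for $\mathcal V\in\mathcal M_{\le\omega}$; unions are set unions; $\mathcal U^*:=\alpha_*(\gamma_*(\mathcal U)^*)$; $\mathcal U^\omega:=\alpha_{\le\omega}(\gamma_*(\mathcal U)^\omega)$. Büchi type system. Let $\mathfrak X$ be a set of variables. An expression $\mathcal V(\mathfrak X)$ is a formal expression $\bigcup_{Y\in\mathfrak X}(\mathcal A_Y\cdot Y)\cup\mathcal B$ with $\mathcal A_Y\in\mathcal M_*$, $\mathcal B\in\mathcal M_{\le\omega}$; $\mathcal V(\mathfrak X-X)$ denotes one with $\mathcal A_X=\emptyset$; a variable $X$ denotes the expression with $\mathcal A_X=\{\{\epsilon\}\}$, other coefficients empty; $\mathcal B$ denotes the expression with all $\mathcal A_Y=\emptyset$. $\mathcal A\cdot\mathcal V(\mathfrak X)=\bigcup_Y((\mathcal A\cdot\mathcal A_Y)\cdot Y)\cup(\mathcal A\cdot\mathcal B)$; $\cup$ componentwise. For $\eta:\mathfrak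 X\to\mathcal M_{\le\omega}$, $\mathcal V(\eta)=\bigcup_Y\mathcal A_Y\cdot\eta(Y)\cup\mathcal B$. An environment $\Delta$ is a finite set of bindings $f\ \&\ (\mathcal U,X)$ ($f\in\mathcal F$, $\mathcal U\in\mathcal M_*$, $X\in\mathfrak X$), distinct bindings with distinct variables. Rules: (i) $\Delta\vdash_{\mathfrak A}o(a)\ \&\ (\alpha_*(\{a\}),\emptyset)$; (ii) from $\Delta\vdash_{\mathfrak A}e_1\ \&\ (\mathcal U_1,\mathcal V_1(\mathfrak X))$ and $\Delta\vdash_{\mathfrak A}e_2\ \&\ (\mathcal U_2,\mathcal V_2(\mathfrak X))$ infer $\Delta\vdash_{\mathfrak A}e_1;e_2\ \&\ (\mathcal U_1\cdot\mathcal U_2,\mathcal V_1(\mathfrak X)\cup\mathcal U_1\cdot\mathcal V_2(\mathfrak X))$; (iii) from the same premises infer $\Delta\vdash_{\mathfrak A}e_1?e_2\ \&\ (\mathcal U_1\cup\mathcal U_2,\mathcal V_1(\mathfrak X)\cup\mathcal V_2(\mathfrak X))$; (iv) $\Delta,f\ \&\ (\mathcal U,X)\vdash_{\mathfrak A}f\ \&\ (\mathcal U,X)$; (v) from $\Delta,f\ \&\ (\mathcal U,X)\vdash_{\mathfrak A}e_f\ \&\ (\mathcal U,\mathcal A\cdot X\cup\mathcal V(\mathfrak X-X))$ infer $\Delta\vdash_{\mathfrak A}f\ \&\ (\mathcal U,\mathcal A^*\cdot\mathcal V(\mathfrak X-X)\cup\mathcal A^\omega)$. $\Delta$ is justified if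 for each binding $f\ \&\ (\mathcal U,X)$ in $\Delta$ there are $\mathcal A$, $\mathcal V(\mathfrak X-X)$ with $\Delta\vdash_{\mathfrak A}e_f\ \&\ (\mathcal U,\mathcal A\cdot X\cup\mathcal V(\mathfrak X-X))$. $\eta\models_{\mathfrak A}\Delta$ means $\Delta$ is justified and for each binding $g\ \&\ (\mathcal U',Y)$ in $\Delta$ and each $w$ with $g\uparrow w$, $w\in\gamma_{\le\omega}(\eta(Y))$.
   Formalization: The rule for completed calls is corrected to: e_f ⇓ w implies f ⇓ ✓w (printed: f ⇓ w). As printed the claim fails: for e_f = o(a)?(f;o(a)) one gets f ↑ a^ω, while f has type (α_*(a⁺), {ε}^ω), which covers only ε. Excluded middle is assumed. -}

module Defs where

open import Data.Empty using (⊥)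
open import Data.Fin using (Fin)
open import Data.Fin.Subset using (Subset) renaming (_∈_ to _∈ˢ_)
open import Data.List using (List; []; _∷_; _++_; [_]; concat; applyUpTo; catMaybes)
open import Data.List.Membership.Propositional using () renaming (_∈_ to _∈ˡ_)
open import Data.List.Properties using (++-assoc; ++-identityʳ; ∷-injective)
open import Data.List.Relation.Unary.All using (All)
open import Data.Maybe using (Maybe; just; nothing)
open import Data.Nat using (ℕ; zero; suc)
open import Data.Nat.GeneralisedArithmetic using (fold)
open import Data.Product using (Σ-syntax; ∃; ∃-syntax; _×_; _,_; proj₁; proj₂)
open import Data.Sum using (_⊎_; inj₁; inj₂)
open import Function using (_∘_; _⇔_; mk⇔; Equivalence)
open import Level using (0ℓ)
open import Relation.Binary.PropositionalEquality
  using (_≡_; _≗_; refl; sym; trans; cong; cong₂; subst)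
open import Relation.Binary.Definitions using (_Respects_)
open import Relation.Unary using (Pred; _∈_; _⊆_; _≐_; _∪_; ⋃; ∅; ｛_｝)

data Word (A : Set) : Set where
  fin : List A → Word A
  inf : (ℕ → A) → Word A

private
  variable
    A : Set

-- Infinite words are functions, hence compared pointwise.
infix 4 _≋_
_≋_ : Word A → Word A → Set
fin u ≋ fin v = u ≡ v
inf s ≋ inf t = s ≗ t
fin _ ≋ inf _ = ⊥
inf _ ≋ fin _ = ⊥

infixr 5 _∷ʷ_ _◁_
_∷ʷ_ : A → Word A → Word A
a ∷ʷ fin u = fin (a ∷ u)
a ∷ʷ inf s = inf λ { zero → a ; (suc n) → s n }

_◁_ : List A → Word A → Word A
[]      ◁ w = w
(a ∷ u) ◁ w = a ∷ʷ (u ◁ w)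

infix 4 _⊑_
_⊑_ : List A → Word A → Set
u ⊑ w = ∃[ v ] u ◁ v ≋ w

-- For a chain u 0, u 1, … of finite words, each a prefix of the next, this
-- says that w is its supremum; w is finite exactly when the chain is
-- eventually constant.
infix 4 _LimitOf_
_LimitOf_ : Word A → (ℕ → List A) → Set
w LimitOf u = (∀ n → u n ⊑ w) × (∀ v → v ⊑ w → ∃[ n ] v ⊑ fin (u n))

infix 4 _IsConcatOf_
_IsConcatOf_ : Word A → (ℕ → List A) → Set
w IsConcatOf u = w LimitOf λ n → concat (applyUpTo u n)

infixr 7 _⊙_
_⊙_ : Pred (List A) 0ℓ → Pred (Word A) 0ℓ → Pred (Word A) 0ℓ
(L ⊙ V) w = ∃[ u ] ∃[ v ] u ∈ L × v ∈ V × w ≋ u ◁ v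

infix 9 _⋆ _^ω
_⋆ : Pred (List A) 0ℓ → Pred (List A) 0ℓ
(L ⋆) w = ∃[ us ] All L us × concat us ≡ w

-- Contains finite words as soon as [] ∈ L.
_^ω : Pred (List A) 0ℓ → Pred (Word A) 0ℓ
(L ^ω) w = ∃[ u ] (∀ n → u n ∈ L) × w IsConcatOf u

data Exp (k m : ℕ) : Set where
  o    : Fin k → Exp k m
  call : Fin m → Exp k m
  _⨾_  : Exp k m → Exp k m → Exp k m
  _¿_  : Exp k m → Exp k m → Exp k m

record Program (k : ℕ) : Set where
  field
    procs : ℕ
    body  : Fin procs → Exp k procs

pattern ✓ = nothing

θ : List (Maybe A) → List A
θ = catMaybes

module Semantics {k : ℕ} (P : Program k) where
  open Program P

  Expr : Set
  Expr = Exp k procs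

  infix 4 _⇓_ _⇑_ _↓_ _↑_

  -- Completed calls are marked with ✓, just as pending ones are.  This does
  -- not affect _↓_, but _↑_ depends on it: if completed calls were unmarked,
  -- f = o(a) ? (f ; o(a)) would satisfy f ⇓ aⁿ and hence f ⇑ ✓aⁿ for all
  -- n ≥ 1, which would make a^ω an infinite trace of f, although every
  -- infinite run of f is a silent left recursion.
  data _⇓_ : Expr → List (Maybe (Fin k)) → Set where
    ⇓-o    : ∀ {a} → o a ⇓ [ just a ]
    ⇓-call : ∀ {f w} → body f ⇓ w → call f ⇓ ✓ ∷ w
    ⇓-seq  : ∀ {e₁ e₂ w u} → e₁ ⇓ w → e₂ ⇓ u → (e₁ ⨾ e₂) ⇓ w ++ u
    ⇓-?₁   : ∀ {e₁ e₂ w} → e₁ ⇓ w → (e₁ ¿ e₂) ⇓ w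
    ⇓-?₂   : ∀ {e₁ e₂ w} → e₂ ⇓ w → (e₁ ¿ e₂) ⇓ w

  data _⇑_ : Expr → List (Maybe (Fin k)) → Set where
    ⇑-o    : ∀ {a} → o a ⇑ [ just a ]
    ⇑-ε    : ∀ {e} → e ⇑ []
    ⇑-call : ∀ {f w} → body f ⇑ w → call f ⇑ ✓ ∷ w
    ⇑-seq₂ : ∀ {e₁ e₂ w u} → e₁ ⇓ w → e₂ ⇑ u → (e₁ ⨾ e₂) ⇑ w ++ u
    ⇑-seq₁ : ∀ {e₁ e₂ w} → e₁ ⇑ w → (e₁ ⨾ e₂) ⇑ w
    ⇑-?₁   : ∀ {e₁ e₂ w} → e₁ ⇑ w → (e₁ ¿ e₂) ⇑ w
    ⇑-?₂   : ∀ {e₁ e₂ w} → e₂ ⇑ w → (e₁ ¿ e₂) ⇑ w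

  _↓_ : Expr → List (Fin k) → Set
  e ↓ w = ∃[ w′ ] e ⇓ w′ × w ≡ θ w′

  -- θ of an infinite word is the limit of θ of its finite prefixes, which
  -- may be a finite word.
  _↑_ : Expr → Word (Fin k) → Set
  e ↑ w = Σ[ w′ ∈ (ℕ → Maybe (Fin k)) ]
    (∀ n → e ⇑ applyUpTo w′ n) × w LimitOf (λ n → θ (applyUpTo w′ n))

≋-refl : ∀ {w : Word A} → w ≋ w
≋-refl {w = fin _} = refl
≋-refl {w = inf _} = λ _ → refl

≋-sym : ∀ {v w : Word A} → v ≋ w → w ≋ v
≋-sym {v = fin _} {fin _} p = sym p
≋-sym {v = inf _} {inf _} p = sym ∘ p

≋-trans : ∀ {u v w : Word A} → u ≋ v → v ≋ w → u ≋ w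
≋-trans {u = fin _} {fin _} {fin _} p q = trans p q
≋-trans {u = inf _} {inf _} {inf _} p q = λ n → trans (p n) (q n)

≋-reflexive : ∀ {v w : Word A} → v ≡ w → v ≋ w
≋-reflexive refl = ≋-refl

∷ʷ-cong : ∀ (a : A) {v w} → v ≋ w → a ∷ʷ v ≋ a ∷ʷ w
∷ʷ-cong a {fin _} {fin _} p = cong (a ∷_) p
∷ʷ-cong a {inf _} {inf _} p = λ { zero → refl ; (suc n) → p n }

∷ʷ-injective : ∀ {a b : A} {v w} → a ∷ʷ v ≋ b ∷ʷ w → a ≡ b × v ≋ w
∷ʷ-injective {v = fin _} {fin _} p = ∷-injective p
∷ʷ-injective {v = inf _} {inf _} p = p 0 , p ∘ suc

◁-cong : ∀ (u : List A) {v w} → v ≋ w → u ◁ v ≋ u ◁ w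
◁-cong []      p = p
◁-cong (a ∷ u) p = ∷ʷ-cong a (◁-cong u p)

◁-cancel : ∀ (u : List A) {v w} → u ◁ v ≋ u ◁ w → v ≋ w
◁-cancel []      p = p
◁-cancel (a ∷ u) p = ◁-cancel u (proj₂ (∷ʷ-injective p))

◁-assoc : ∀ (u v : List A) w → (u ++ v) ◁ w ≡ u ◁ (v ◁ w)
◁-assoc []      v w = refl
◁-assoc (a ∷ u) v w = cong (a ∷ʷ_) (◁-assoc u v w)

◁-fin : ∀ (u v : List A) → u ◁ fin v ≡ fin (u ++ v)
◁-fin []      v = refl
◁-fin (a ∷ u) v = cong (a ∷ʷ_) (◁-fin u v)

⊑-◁ : ∀ (u : List A) {v w} → v ⊑ w → u ++ v ⊑ u ◁ w
⊑-◁ u {v} (x , p) = x , ≋-trans (≋-reflexive (◁-assoc u v x)) (◁-cong u p)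

⊑-◁⁻¹ : ∀ (u : List A) {v w} → u ++ v ⊑ u ◁ w → v ⊑ w
⊑-◁⁻¹ u {v} (x , p) =
  x , ◁-cancel u (≋-trans (≋-reflexive (sym (◁-assoc u v x))) p)

⊑-fin : ∀ {u v : List A} → u ⊑ fin v → ∃[ r ] u ++ r ≡ v
⊑-fin {u = u} (fin r , p) = r , fin-inj (≋-trans (≋-reflexive (sym (◁-fin u r))) p)
  where
  fin-inj : ∀ {x y : List _} → fin x ≋ fin y → x ≡ y
  fin-inj p = p
⊑-fin {u = a ∷ u} {b ∷ v} (inf s , p) =
  let q , q′ = ∷ʷ-injective {v = u ◁ inf s} {w = fin v} p
      r , r′ = ⊑-fin {u = u} (inf s , q′)
  in r , cong₂ _∷_ q r′
⊑-fin {u = a ∷ u} {[]} (inf s , p) with u ◁ inf s | p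
... | fin _ | ()
... | inf _ | ()

-- A prefix of u ◁ w is a prefix of u, or extends u by a prefix of w.
⊑-split : ∀ (u : List A) {v w} → v ⊑ u ◁ w →
  v ⊑ fin u ⊎ ∃[ v′ ] v ≡ u ++ v′ × v′ ⊑ w
⊑-split []      {v}     p = inj₂ (v , refl , p)
⊑-split (a ∷ u) {[]}    p = inj₁ (fin (a ∷ u) , refl)
⊑-split (a ∷ u) {b ∷ v} {w} (x , p)
  with refl , p′ ← ∷ʷ-injective {v = v ◁ x} {w = u ◁ w} p
  with ⊑-split u {v} {w} (x , p′)
... | inj₁ (y , q)        = inj₁ (y , ∷ʷ-cong a {v ◁ y} {fin u} q)
... | inj₂ (v′ , q , q′)  = inj₂ (v′ , cong (a ∷_) q , q′)

^ω-unfold : ∀ (L : Pred (List A) 0ℓ) {w} → w ∈ L ^ω → w ∈ L ⊙ L ^ω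
^ω-unfold L {w} (u , u∈L , below , least) with below 1
... | z , p = u 0 , z , u∈L 0 , (u ∘ suc , u∈L ∘ suc , below′ , least′) ,
              ≋-sym p′
  where
  p′ : u 0 ◁ z ≋ w
  p′ = subst (λ x → x ◁ z ≋ w) (++-identityʳ (u 0)) p
  below′ : ∀ n → concat (applyUpTo (u ∘ suc) n) ⊑ z
  below′ n with below (suc n)
  ... | x , q = ⊑-◁⁻¹ (u 0) (x , ≋-trans q (≋-sym p′))
  least′ : ∀ v → v ⊑ z → ∃[ n ] v ⊑ fin (concat (applyUpTo (u ∘ suc) n))
  least′ v (x , q)
    with least (u 0 ++ v)
           (x , ≋-trans (≋-reflexive (◁-assoc (u 0) v x)) (≋-trans (◁-cong (u 0) q) p′))
  ... | suc n , r = n , ⊑-◁⁻¹ (u 0)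
                          (subst (u 0 ++ v ⊑_) (sym (◁-fin (u 0) _)) r)
  ... | zero  , r = 0 , ⊑-[] (u 0) v (⊑-fin {u = u 0 ++ v} r)
    where
    ⊑-[] : ∀ x y → ∃[ r ] (x ++ y) ++ r ≡ [] → y ⊑ fin []
    ⊑-[] [] [] _ = fin [] , refl

^ω-mono : ∀ (K L : Pred (List A) 0ℓ) → K ⊆ L → K ^ω ⊆ L ^ω
^ω-mono K L K⊆L (u , u∈K , lim) = u , K⊆L ∘ u∈K , lim

record ExtendedBüchiAutomaton (k : ℕ) : Set where
  field
    states : ℕ
    δ      : Fin states → Fin k → Subset states
    q₀     : Fin states
    F      : Subset states

module Abstraction {k : ℕ} (𝔄 : ExtendedBüchiAutomaton k) where
  open ExtendedBüchiAutomaton 𝔄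

  infix 4 _⇝[_]_ _⇝ꟳ[_]_ _∼_ _≈_

  data _⇝[_]_ : Fin states → List (Fin k) → Fin states → Set where
    done : ∀ {p} → p ⇝[ [] ] p
    step : ∀ {p a r w q} → r ∈ˢ δ p a → r ⇝[ w ] q → p ⇝[ a ∷ w ] q

  _⇝ꟳ[_]_ : Fin states → List (Fin k) → Fin states → Set
  p ⇝ꟳ[ w ] q = ∃[ u ] ∃[ v ] ∃[ r ]
    w ≡ u ++ v × p ⇝[ u ] r × r ∈ˢ F × r ⇝[ v ] q

  _∼_ : List (Fin k) → List (Fin k) → Set
  w ∼ u = ∀ p q → (p ⇝[ w ] q ⇔ p ⇝[ u ] q) × (p ⇝ꟳ[ w ] q ⇔ p ⇝ꟳ[ u ] q)

  -- The set Σ⁺/∼ ⊎ {{ε}} as a setoid: a class is given by any of its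
  -- elements, and [] is alone in its class.
  record 𝒬 : Set where
    constructor ⟦_⟧
    field rep : List (Fin k)
  open 𝒬

  data _≈_ : 𝒬 → 𝒬 → Set where
    ε≈ε : ⟦ [] ⟧ ≈ ⟦ [] ⟧
    +≈+ : ∀ {a w b u} → a ∷ w ∼ b ∷ u → ⟦ a ∷ w ⟧ ≈ ⟦ b ∷ u ⟧

  lang : 𝒬 → Pred (List (Fin k)) 0ℓ
  lang C w = ⟦ w ⟧ ≈ C

  infixl 7 _∙_
  _∙_ : 𝒬 → 𝒬 → 𝒬
  C ∙ D = ⟦ rep C ++ rep D ⟧

  𝒞 : Pred (𝒬 × 𝒬) 0ℓ
  𝒞 (C , D) = C ∙ D ≈ C × D ∙ D ≈ D

  ⟪_⟫ : 𝒬 × 𝒬 → Pred (Word (Fin k)) 0ℓ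
  ⟪ C , D ⟫ = lang C ⊙ lang D ^ω

  𝔣 : Pred (Word (Fin k)) 0ℓ → Pred (𝒬 × 𝒬) 0ℓ
  𝔣 V p = p ∈ 𝒞 × ∃[ w ] w ∈ ⟪ p ⟫ × w ∈ V

  𝔤 : Pred (𝒬 × 𝒬) 0ℓ → Pred (Word (Fin k)) 0ℓ
  𝔤 𝒱 w = ∃[ p ] p ∈ 𝒱 × w ∈ ⟪ p ⟫

  𝔠 : Pred (𝒬 × 𝒬) 0ℓ → Pred (𝒬 × 𝒬) 0ℓ
  𝔠 𝒱 p = ∃[ n ] p ∈ fold 𝒱 (𝔣 ∘ 𝔤) (suc n)

  record ℳ⁎ : Set₁ where
    field
      set  : Pred 𝒬 0ℓ
      resp : set Respects _≈_

  -- Equality in ℳω is _≐ω_; language is only a witness.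
  record ℳω : Set₁ where
    field
      set      : Pred (𝒬 × 𝒬) 0ℓ
      language : Pred (Word (Fin k)) 0ℓ
      set≐     : set ≐ 𝔠 (𝔣 language)

  infix 4 _≐⁎_ _≐ω_
  _≐⁎_ : ℳ⁎ → ℳ⁎ → Set
  𝒰 ≐⁎ 𝒰′ = ℳ⁎.set 𝒰 ≐ ℳ⁎.set 𝒰′

  _≐ω_ : ℳω → ℳω → Set
  𝒱 ≐ω 𝒱′ = ℳω.set 𝒱 ≐ ℳω.set 𝒱′

  γ⁎ : ℳ⁎ → Pred (List (Fin k)) 0ℓ
  γ⁎ 𝒰 w = ∃[ C ] C ∈ ℳ⁎.set 𝒰 × w ∈ lang C

  γω : ℳω → Pred (Word (Fin k)) 0ℓ
  γω 𝒱 = 𝔤 (ℳω.set 𝒱)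

  αω : Pred (Word (Fin k)) 0ℓ → ℳω
  αω V = record { set = 𝔠 (𝔣 V) ; language = V ; set≐ = (λ x → x) , (λ x → x) }

  ∼-refl : ∀ {w} → w ∼ w
  ∼-refl p q = mk⇔ (λ x → x) (λ x → x) , mk⇔ (λ x → x) (λ x → x)

  open Equivalence

  ∼-sym : ∀ {w u} → w ∼ u → u ∼ w
  ∼-sym e p q = let g , h = e p q in mk⇔ (from g) (to g) , mk⇔ (from h) (to h)

  ∼-trans : ∀ {w u v} → w ∼ u → u ∼ v → w ∼ v
  ∼-trans e e′ p q =
    let g , h = e p q ; g′ , h′ = e′ p q in
    mk⇔ (to g′ ∘ to g) (from g ∘ from g′) , mk⇔ (to h′ ∘ to h) (from h ∘ from h′)

  ≈-refl : ∀ {C} → C ≈ C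
  ≈-refl {⟦ [] ⟧}    = ε≈ε
  ≈-refl {⟦ _ ∷ _ ⟧} = +≈+ ∼-refl

  ≈-reflexive : ∀ {C D} → C ≡ D → C ≈ D
  ≈-reflexive refl = ≈-refl

  ≈-sym : ∀ {C D} → C ≈ D → D ≈ C
  ≈-sym ε≈ε     = ε≈ε
  ≈-sym (+≈+ p) = +≈+ (∼-sym p)

  ≈-trans : ∀ {C D E} → C ≈ D → D ≈ E → C ≈ E
  ≈-trans ε≈ε     ε≈ε     = ε≈ε
  ≈-trans (+≈+ p) (+≈+ q) = +≈+ (∼-trans p q)

  ⇝-++ : ∀ {p w r u q} → p ⇝[ w ] r → r ⇝[ u ] q → p ⇝[ w ++ u ] q
  ⇝-++ done       y = y
  ⇝-++ (step s x) y = step s (⇝-++ x y)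

  ⇝-split : ∀ {p} w {u q} → p ⇝[ w ++ u ] q → ∃[ r ] p ⇝[ w ] r × r ⇝[ u ] q
  ⇝-split []      y          = _ , done , y
  ⇝-split (_ ∷ w) (step s x) = let r , x′ , y = ⇝-split w x in r , step s x′ , y

  ⇝ꟳ-++ˡ : ∀ {p w r u q} → p ⇝ꟳ[ w ] r → r ⇝[ u ] q → p ⇝ꟳ[ w ++ u ] q
  ⇝ꟳ-++ˡ {u = u} (x , y , r , refl , px , r∈F , ry) z =
    x , y ++ u , r , ++-assoc x y u , px , r∈F , ⇝-++ ry z

  ⇝ꟳ-++ʳ : ∀ {p w r u q} → p ⇝[ w ] r → r ⇝ꟳ[ u ] q → p ⇝ꟳ[ w ++ u ] q
  ⇝ꟳ-++ʳ {w = w} z (x , y , r , refl , px , r∈F , ry) =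
    w ++ x , y , r , sym (++-assoc w x y) , ⇝-++ z px , r∈F , ry

  ⇝ꟳ-split : ∀ {p} w {u q} → p ⇝ꟳ[ w ++ u ] q →
    (∃[ r ] p ⇝ꟳ[ w ] r × r ⇝[ u ] q) ⊎ (∃[ r ] p ⇝[ w ] r × r ⇝ꟳ[ u ] q)
  ⇝ꟳ-split []      x = inj₂ (_ , done , x)
  ⇝ꟳ-split (a ∷ w) ([] , _ , r , refl , done , r∈F , x) =
    let s , y , z = ⇝-split (a ∷ w) x
    in inj₁ (s , ([] , a ∷ w , r , refl , done , r∈F , y) , z)
  ⇝ꟳ-split (a ∷ w) (b ∷ x , y , r , eq , step s px , r∈F , ry)
    with refl , eq′ ← ∷-injective eq
    with ⇝ꟳ-split w (x , y , r , eq′ , px , r∈F , ry)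
  ... | inj₁ (t , (x′ , y′ , r′ , eq″ , px′ , r′∈F , ry′) , z) =
    inj₁ (t , (a ∷ x′ , y′ , r′ , cong (a ∷_) eq″ , step s px′ , r′∈F , ry′) , z)
  ... | inj₂ (t , y′ , z) = inj₂ (t , step s y′ , z)

  ∼-cong : ∀ {w w′ u u′} → w ∼ w′ → u ∼ u′ → w ++ u ∼ w′ ++ u′
  ∼-cong e e′ p q =
    mk⇔ (half e e′) (half (∼-sym e) (∼-sym e′)) ,
    mk⇔ (halfꟳ e e′) (halfꟳ (∼-sym e) (∼-sym e′))
    where
    half : ∀ {w w′ u u′ p q} → w ∼ w′ → u ∼ u′ → p ⇝[ w ++ u ] q → p ⇝[ w′ ++ u′ ] q
    half {w} e e′ x = let r , y , z = ⇝-split w x in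
      ⇝-++ (to (proj₁ (e _ _)) y) (to (proj₁ (e′ _ _)) z)
    halfꟳ : ∀ {w w′ u u′ p q} → w ∼ w′ → u ∼ u′ → p ⇝ꟳ[ w ++ u ] q → p ⇝ꟳ[ w′ ++ u′ ] q
    halfꟳ {w} e e′ x with ⇝ꟳ-split w x
    ... | inj₁ (r , y , z) = ⇝ꟳ-++ˡ (to (proj₂ (e _ _)) y) (to (proj₁ (e′ _ _)) z)
    ... | inj₂ (r , y , z) = ⇝ꟳ-++ʳ (to (proj₁ (e _ _)) y) (to (proj₂ (e′ _ _)) z)

  ∙-cong : ∀ {C C′ D D′} → C ≈ C′ → D ≈ D′ → C ∙ D ≈ C′ ∙ D′
  ∙-cong ε≈ε     q       = q
  ∙-cong (+≈+ {a} {w} {b} {u} p) ε≈ε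
    rewrite ++-identityʳ w | ++-identityʳ u = +≈+ p
  ∙-cong (+≈+ p) (+≈+ q) = +≈+ (∼-cong p q)

  ∙-congˡ : ∀ C {D D′} → D ≈ D′ → C ∙ D ≈ C ∙ D′
  ∙-congˡ C = ∙-cong (≈-refl {C})

  ∙-congʳ : ∀ {C C′} D → C ≈ C′ → C ∙ D ≈ C′ ∙ D
  ∙-congʳ D p = ∙-cong p (≈-refl {D})

  ∙-assoc : ∀ C D E → (C ∙ D) ∙ E ≈ C ∙ (D ∙ E)
  ∙-assoc C D E = ≈-reflexive (cong ⟦_⟧ (++-assoc (rep C) (rep D) (rep E)))

  ⟪⟫-cong : ∀ {C C′ D D′} → C ≈ C′ → D ≈ D′ → ⟪ C , D ⟫ ⊆ ⟪ C′ , D′ ⟫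
  ⟪⟫-cong {D = D} {D′} p q (u , v , u∈C , v∈D , eq) =
    u , v , ≈-trans u∈C p , ^ω-mono (lang D) (lang D′) (λ x → ≈-trans x q) v∈D , eq

  𝒞-resp : ∀ {C C′ D D′} → C ≈ C′ → D ≈ D′ → 𝒞 (C , D) → 𝒞 (C′ , D′)
  𝒞-resp p q (cd , dd) =
    ≈-trans (≈-sym (∙-cong p q)) (≈-trans cd p) ,
    ≈-trans (≈-sym (∙-cong q q)) (≈-trans dd q)

  -- ℳω consists of exactly the fixed points of 𝔣 ∘ 𝔤, which gives its closure
  -- under ∅, unions and multiplication by ℳ⁎.
  𝔣𝔤-mono : ∀ {𝒱 𝒱′} → 𝒱 ⊆ 𝒱′ → 𝔣 (𝔤 𝒱) ⊆ 𝔣 (𝔤 𝒱′)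
  𝔣𝔤-mono s (p∈𝒞 , w , w∈p , p′ , p′∈𝒱 , w∈p′) =
    p∈𝒞 , w , w∈p , p′ , s p′∈𝒱 , w∈p′

  ℳω-fix : (𝒱 : ℳω) → 𝔣 (𝔤 (ℳω.set 𝒱)) ≐ ℳω.set 𝒱
  ℳω-fix 𝒱 = closed , open′
    where
    open ℳω 𝒱
    closed : 𝔣 (𝔤 set) ⊆ set
    closed (p∈𝒞 , w , w∈p , p′ , p′∈𝒱 , w∈p′) =
      let n , x = proj₁ set≐ p′∈𝒱
      in proj₂ set≐ (suc n , p∈𝒞 , w , w∈p , p′ , x , w∈p′)
    open′ : set ⊆ 𝔣 (𝔤 set)
    open′ p∈𝒱 =
      let n , p∈𝒞 , w , w∈p , _ = proj₁ set≐ p∈𝒱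
      in p∈𝒞 , w , w∈p , _ , p∈𝒱 , w∈p

  fromFix : (𝒱 : Pred (𝒬 × 𝒬) 0ℓ) → 𝔣 (𝔤 𝒱) ≐ 𝒱 → ℳω
  fromFix 𝒱 (closed , open′) = record
    { set      = 𝒱
    ; language = 𝔤 𝒱
    ; set≐     = (λ p∈𝒱 → 0 , 𝔣𝔤-mono open′ (open′ p∈𝒱))
               , (λ { (n , x) → iter (suc n) x })
    }
    where
    iter : ∀ n → fold (𝔣 (𝔤 𝒱)) (𝔣 ∘ 𝔤) n ⊆ 𝒱
    iter zero    x = closed x
    iter (suc n) x = closed (𝔣𝔤-mono (iter n) x)

  infixr 7 _·_ _·ω_
  infixr 6 _∪⁎_ _∪ω_
  infix  9 _⋆ᵃ _^ωᵃ

  ∅⁎ : ℳ⁎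
  ∅⁎ = record { set = ∅ ; resp = λ _ () }

  α⁎ : Pred (List (Fin k)) 0ℓ → ℳ⁎
  α⁎ U = record
    { set  = λ C → ∃[ w ] w ∈ lang C × w ∈ U
    ; resp = λ { p (w , w∈C , w∈U) → w , ≈-trans w∈C p , w∈U }
    }

  ｛ε｝ : ℳ⁎
  ｛ε｝ = record { set = ⟦ [] ⟧ ≈_ ; resp = λ p q → ≈-trans q p }

  _·_ : ℳ⁎ → ℳ⁎ → ℳ⁎
  𝒰 · 𝒰′ = record
    { set  = λ E → ∃[ C ] ∃[ C′ ] C ∈ ℳ⁎.set 𝒰 × C′ ∈ ℳ⁎.set 𝒰′ × E ≈ C ∙ C′
    ; resp = λ { p (C , C′ , x , y , q) → C , C′ , x , y , ≈-trans (≈-sym p) q }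
    }

  _∪⁎_ : ℳ⁎ → ℳ⁎ → ℳ⁎
  𝒰 ∪⁎ 𝒰′ = record
    { set  = ℳ⁎.set 𝒰 ∪ ℳ⁎.set 𝒰′
    ; resp = λ { p (inj₁ x) → inj₁ (ℳ⁎.resp 𝒰 p x)
               ; p (inj₂ x) → inj₂ (ℳ⁎.resp 𝒰′ p x) }
    }

  _⋆ᵃ : ℳ⁎ → ℳ⁎
  𝒰 ⋆ᵃ = α⁎ (γ⁎ 𝒰 ⋆)

  _^ωᵃ : ℳ⁎ → ℳω
  𝒰 ^ωᵃ = αω (γ⁎ 𝒰 ^ω)

  ∅ω : ℳω
  ∅ω = fromFix ∅ ((λ { (_ , _ , _ , _ , () , _) }) , λ ())

  ⋃ω : (I : Set) → (I → ℳω) → ℳω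
  ⋃ω I 𝒱 = fromFix (⋃ I (ℳω.set ∘ 𝒱))
    ( (λ { (p∈𝒞 , w , w∈p , p′ , (i , x) , w∈p′) →
             i , proj₁ (ℳω-fix (𝒱 i)) (p∈𝒞 , w , w∈p , p′ , x , w∈p′) })
    , (λ { (i , x) → 𝔣𝔤-mono (i ,_) (proj₂ (ℳω-fix (𝒱 i)) x) }) )

  _∪ω_ : ℳω → ℳω → ℳω
  𝒱 ∪ω 𝒱′ = fromFix (ℳω.set 𝒱 ∪ ℳω.set 𝒱′)
    ( (λ { (p∈𝒞 , w , w∈p , p′ , inj₁ x , w∈p′) →
             inj₁ (proj₁ (ℳω-fix 𝒱) (p∈𝒞 , w , w∈p , p′ , x , w∈p′))
         ; (p∈𝒞 , w , w∈p , p′ , inj₂ x , w∈p′) →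
             inj₂ (proj₁ (ℳω-fix 𝒱′) (p∈𝒞 , w , w∈p , p′ , x , w∈p′)) })
    , (λ { (inj₁ x) → 𝔣𝔤-mono inj₁ (proj₂ (ℳω-fix 𝒱) x)
         ; (inj₂ x) → 𝔣𝔤-mono inj₂ (proj₂ (ℳω-fix 𝒱′) x) }) )

  -- If e u₀ u₁ … = w with e ∈ E and uᵢ ∈ D, where ED = E, and b is a prefix
  -- of w, then w = b r z for some r with br ∈ E and z ∈ D^ω.
  cut : ∀ {E D w b} → E ∙ D ≈ E → w ∈ ⟪ E , D ⟫ → b ⊑ w →
    ∃[ r ] ∃[ z ] ⟦ b ++ r ⟧ ≈ E × z ∈ lang D ^ω × w ≋ (b ++ r) ◁ z
  cut {E} {D} {w} {b} ED≈E (e , x , e∈E , x∈D@(u , u∈D , lim) , w≋) (y , by≋w) =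
    let n , s = bound in let r , z , p = go n e e∈E x∈D s in
    r , z , p .proj₁ , p .proj₂ .proj₁ , ≋-trans w≋ (p .proj₂ .proj₂)
    where
    bound : ∃[ n ] b ⊑ fin (e ++ concat (applyUpTo u n))
    bound with ⊑-split e {b} (y , ≋-trans by≋w w≋)
    ... | inj₁ b⊑e = 0 , subst (λ t → b ⊑ fin t) (sym (++-identityʳ e)) b⊑e
    ... | inj₂ (b′ , refl , b′⊑x) =
      let n , t = proj₂ lim b′ b′⊑x in
      n , subst (e ++ b′ ⊑_) (◁-fin e _) (⊑-◁ e t)
    go : ∀ n {x} e → e ∈ lang E → (x∈ : x ∈ lang D ^ω) →
      b ⊑ fin (e ++ concat (applyUpTo (proj₁ x∈) n)) →
      ∃[ r ] ∃[ z ] ⟦ b ++ r ⟧ ≈ E × z ∈ lang D ^ω × e ◁ x ≋ (b ++ r) ◁ z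
    go zero {x} e e∈E x∈ s with ⊑-fin {u = b} s
    ... | r , eq with refl ← trans eq (++-identityʳ e) = r , x , e∈E , x∈ , ≋-refl
    go (suc n) {x} e e∈E x∈@(u , u∈D , lim) s =
      let _ , z , _ , z∈D , eq = ^ω-unfold (lang D) x∈
          r , z′ , p , q , eq′ =
            go n (e ++ u 0) (≈-trans (∙-cong e∈E (u∈D 0)) ED≈E) z∈D
              (subst (λ t → b ⊑ fin t) (sym (++-assoc e (u 0) _)) s)
      in r , z′ , p , q ,
         ≋-trans (◁-cong e eq) (≋-trans (≋-reflexive (sym (◁-assoc e (u 0) z))) eq′)

  _·ω_ : ℳ⁎ → ℳω → ℳω
  𝒰 ·ω 𝒱 = fromFix 𝒲 (closed , open′)
    where
    𝒲 : Pred (𝒬 × 𝒬) 0ℓ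
    𝒲 (E , D′) = ∃[ A ] ∃[ C ] ∃[ D ]
      A ∈ ℳ⁎.set 𝒰 × (C , D) ∈ ℳω.set 𝒱 × E ≈ A ∙ C × D′ ≈ D

    open′ : 𝒲 ⊆ 𝔣 (𝔤 𝒲)
    open′ {E , D′} x@(A , C , D , A∈𝒰 , CD∈𝒱 , E≈AC , D′≈D) =
      let (CD≈C , DD≈D) , w , (c , z , c∈C , z∈D , eq) , _ = proj₂ (ℳω-fix 𝒱) CD∈𝒱
          w′∈ = ⟪⟫-cong (≈-sym E≈AC) (≈-sym D′≈D)
                  (rep A ++ c , z , ∙-congˡ A c∈C , z∈D , ≋-refl)
      in 𝒞-resp (≈-sym E≈AC) (≈-sym D′≈D)
           (≈-trans (∙-assoc A C D) (∙-congˡ A CD≈C) , DD≈D)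
         , (rep A ++ c) ◁ z , w′∈ , (E , D′) , x , w′∈

    closed : 𝔣 (𝔤 𝒲) ⊆ 𝒲
    closed {E , D′} ((ED′≈E , D′D′≈D′) , w , w∈ED′ , (E₁ , D₁) ,
                     (A , C , D , A∈𝒰 , CD∈𝒱 , E₁≈AC , D₁≈D) ,
                     (b , y , b∈E₁ , y∈D₁ , w≋by)) =
      let r , z , br∈E , z∈D′ , w≋brz = cut ED′≈E w∈ED′ (y , ≋-sym w≋by)
          d , z′ , d∈D′ , z′∈D′ , z≋dz′ = ^ω-unfold (lang D′) z∈D′
          c   = rep C
          y≋rz : y ≋ r ◁ z
          y≋rz = ◁-cancel b (≋-trans (≋-sym w≋by)
                   (≋-trans w≋brz (≋-reflexive (◁-assoc b r z))))
          C″  = ⟦ c ++ (r ++ rep D′) ⟧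
          c∙r = ⟦ c ++ r ⟧
          C″≈ : c∙r ∙ D′ ≈ C″
          C″≈ = ∙-assoc C ⟦ r ⟧ D′
          C″∈𝒞 : 𝒞 (C″ , D′)
          C″∈𝒞 = 𝒞-resp C″≈ (≈-refl {D′})
                   (≈-trans (∙-assoc c∙r D′ D′) (∙-congˡ c∙r D′D′≈D′) , D′D′≈D′)
          cy∈C″D′ : c ◁ y ∈ ⟪ C″ , D′ ⟫
          cy∈C″D′ = (c ++ r) ++ d , z′ ,
            ≈-trans (∙-congˡ c∙r d∈D′) C″≈ , z′∈D′ ,
            ≋-trans (◁-cong c (≋-trans y≋rz (◁-cong r z≋dz′)))
              (≋-reflexive (trans (sym (◁-assoc c r (d ◁ z′)))
                                  (sym (◁-assoc (c ++ r) d z′))))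
          cy∈CD : c ◁ y ∈ ⟪ C , D ⟫
          cy∈CD = c , y , ≈-refl , ^ω-mono (lang D₁) (lang D) (λ t → ≈-trans t D₁≈D) y∈D₁ , ≋-refl
          C″∈𝒱 = proj₁ (ℳω-fix 𝒱)
                   (C″∈𝒞 , c ◁ y , cy∈C″D′ , (C , D) , CD∈𝒱 , cy∈CD)
          br≈ : ⟦ b ++ r ⟧ ≈ A ∙ c∙r
          br≈ = ≈-trans (∙-congʳ ⟦ r ⟧ (≈-trans b∈E₁ E₁≈AC)) (∙-assoc A C ⟦ r ⟧)
          E≈ : E ≈ A ∙ C″
          E≈ = ≈-trans (≈-sym ED′≈E)
                 (≈-trans (∙-congʳ D′ (≈-trans (≈-sym br∈E) br≈))
                   (≈-trans (∙-assoc A c∙r D′) (∙-congˡ A C″≈)))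
      in A , C″ , D′ , A∈𝒰 , C″∈𝒱 , E≈ , ≈-refl

module BüchiTypes {k : ℕ} (P : Program k) (𝔄 : ExtendedBüchiAutomaton k) (𝔛 : Set) where
  open Program P
  open Semantics P
  open Abstraction 𝔄

  -- The formal expression ⋃_Y (coeff Y · Y) ∪ const.
  record VExpr : Set₁ where
    field
      coeff : 𝔛 → ℳ⁎
      const : ℳω
  open VExpr

  infix 4 _≐ᵛ_
  _≐ᵛ_ : VExpr → VExpr → Set
  𝒱 ≐ᵛ 𝒱′ = (∀ Y → coeff 𝒱 Y ≐⁎ coeff 𝒱′ Y) × const 𝒱 ≐ω const 𝒱′

  Omits : 𝔛 → VExpr → Set
  Omits X 𝒱 = coeff 𝒱 X ≐⁎ ∅⁎

  var : 𝔛 → VExpr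
  var X = record
    { coeff = λ Y → record
        { set  = λ C → X ≡ Y × C ∈ ℳ⁎.set ｛ε｝
        ; resp = λ { p (q , x) → q , ℳ⁎.resp ｛ε｝ p x }
        }
    ; const = ∅ω
    }

  constᵛ : ℳω → VExpr
  constᵛ ℬ = record { coeff = λ _ → ∅⁎ ; const = ℬ }

  infixr 7 _·ᵛ_
  infixr 6 _∪ᵛ_
  _·ᵛ_ : ℳ⁎ → VExpr → VExpr
  𝒜 ·ᵛ 𝒱 = record { coeff = λ Y → 𝒜 · coeff 𝒱 Y ; const = 𝒜 ·ω const 𝒱 }

  _∪ᵛ_ : VExpr → VExpr → VExpr
  𝒱 ∪ᵛ 𝒱′ = record
    { coeff = λ Y → coeff 𝒱 Y ∪⁎ coeff 𝒱′ Y ; const = const 𝒱 ∪ω const 𝒱′ }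

  _⟨_⟩ : VExpr → (𝔛 → ℳω) → ℳω
  𝒱 ⟨ η ⟩ = ⋃ω 𝔛 (λ Y → coeff 𝒱 Y ·ω η Y) ∪ω const 𝒱

  record Binding : Set₁ where
    constructor _&⟨_,_⟩
    field
      proc   : Fin procs
      effect : ℳ⁎
      tvar   : 𝔛
  open Binding

  _≐ᵇ_ : Binding → Binding → Set
  b ≐ᵇ b′ = proc b ≡ proc b′ × effect b ≐⁎ effect b′ × tvar b ≡ tvar b′

  -- A list stands for the finite set of its entries; repetitions are harmless.
  IsEnvironment : List Binding → Set₁
  IsEnvironment Δ = ∀ {b b′} → b ∈ˡ Δ → b′ ∈ˡ Δ → tvar b ≡ tvar b′ → b ≐ᵇ b′

  infix 3 _⊢_&_,_
  data _⊢_&_,_ (Δ : List Binding) : Expr → ℳ⁎ → VExpr → Set₁ where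
    ⊢-o    : ∀ {a} → Δ ⊢ o a & α⁎ ｛ [ a ] ｝ , constᵛ ∅ω
    ⊢-seq  : ∀ {e₁ e₂ 𝒰₁ 𝒰₂ 𝒱₁ 𝒱₂} → Δ ⊢ e₁ & 𝒰₁ , 𝒱₁ → Δ ⊢ e₂ & 𝒰₂ , 𝒱₂ →
             Δ ⊢ e₁ ⨾ e₂ & 𝒰₁ · 𝒰₂ , 𝒱₁ ∪ᵛ 𝒰₁ ·ᵛ 𝒱₂
    ⊢-?    : ∀ {e₁ e₂ 𝒰₁ 𝒰₂ 𝒱₁ 𝒱₂} → Δ ⊢ e₁ & 𝒰₁ , 𝒱₁ → Δ ⊢ e₂ & 𝒰₂ , 𝒱₂ →
             Δ ⊢ e₁ ¿ e₂ & 𝒰₁ ∪⁎ 𝒰₂ , 𝒱₁ ∪ᵛ 𝒱₂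
    ⊢-var  : ∀ {f 𝒰 X} → (f &⟨ 𝒰 , X ⟩) ∈ˡ Δ → Δ ⊢ call f & 𝒰 , var X
    ⊢-call : ∀ {f 𝒰 X 𝒜 𝒱} →
             IsEnvironment ((f &⟨ 𝒰 , X ⟩) ∷ Δ) → Omits X 𝒱 →
             (f &⟨ 𝒰 , X ⟩) ∷ Δ ⊢ body f & 𝒰 , 𝒜 ·ᵛ var X ∪ᵛ 𝒱 →
             Δ ⊢ call f & 𝒰 , 𝒜 ⋆ᵃ ·ᵛ 𝒱 ∪ᵛ constᵛ (𝒜 ^ωᵃ)
    -- Sets of classes are predicates, so their extensional equality has to
    -- be built into derivability.
    ⊢-≐    : ∀ {e 𝒰 𝒰′ 𝒱 𝒱′} → 𝒰 ≐⁎ 𝒰′ → 𝒱 ≐ᵛ 𝒱′ →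
             Δ ⊢ e & 𝒰 , 𝒱 → Δ ⊢ e & 𝒰′ , 𝒱′

  Justified : List Binding → Set₁
  Justified Δ = ∀ {f 𝒰 X} → (f &⟨ 𝒰 , X ⟩) ∈ˡ Δ →
    ∃[ 𝒜 ] ∃[ 𝒱 ] Omits X 𝒱 × (Δ ⊢ body f & 𝒰 , 𝒜 ·ᵛ var X ∪ᵛ 𝒱)

  infix 4 _⊨_
  _⊨_ : (𝔛 → ℳω) → List Binding → Set₁
  η ⊨ Δ = Justified Δ ×
    (∀ {g 𝒰 Y} → (g &⟨ 𝒰 , Y ⟩) ∈ˡ Δ → ∀ w → call g ↑ w → w ∈ γω (η Y))

-- Along a run, a derivation for e locates the next pending call to a procedure
-- bound in the environment, or else the constant part of the type already
-- accounts for the whole rest of the run.  For a recursive procedure one follows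
-- its own pending calls: either this ends after finitely many rounds, which 𝒜⋆
-- covers, or it goes on forever.  In the latter case the ✓ that opens each call
-- makes the rounds exhaust the run, so that its trace lies in γ(𝒜)^ω.  Since
-- nothing depends on η until the remaining pending calls of Δ are replaced, no
-- fixed point of languages is involved (that argument would fail for ε ∈ 𝒜).
-- Finally γ(𝒜)^ω is contained in its abstraction because, by Ramsey's theorem for
-- the finite-index congruence ∼, every word lies in some C D^ω with (C , D) ∈ 𝒞.
module Submission where

open import Defs
open import Axiom.DoubleNegationElimination using (em⇒dne)
open import Axiom.ExcludedMiddle using (ExcludedMiddle)
open import Data.Empty using (⊥-elim)
open import Data.Fin using (Fin; toℕ; fromℕ<; funToFin; finToFun; combine)
  renaming (zero to fzero; suc to fsuc)
open import Data.Fin.Properties using (toℕ-fromℕ<; finToFun-funToFin; combine-injective)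
open import Data.List using (List; []; _∷_; _++_; [_]; concat; applyUpTo; drop; length)
open import Data.List.Membership.Propositional using () renaming (_∈_ to _∈ˡ_)
open import Data.List.Properties using (++-identityʳ; ∷-injective; length-++; drop-[])
open import Data.List.Relation.Unary.All using ([]; _∷_)
open import Data.List.Relation.Unary.Any using (here; there)
open import Data.Maybe using (Maybe; just)
open import Data.Nat
  using (ℕ; zero; suc; _+_; _*_; _^_; _⊔_; _≤_; _<_; z≤n; s≤s; _<?_; _≤?_)
open import Data.Nat.Properties
open import Data.Product using (Σ-syntax; ∃; ∃-syntax; _×_; _,_; proj₁; proj₂)
open import Data.Sum using (_⊎_; inj₁; inj₂)
open import Data.Unit using (⊤; tt)
open import Function using (_∘_; id; _⇔_; mk⇔)
open import Level using (0ℓ; Level)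
open import Relation.Binary.PropositionalEquality
  using (_≡_; refl; sym; trans; cong; cong₂; subst; subst₂)
open import Relation.Nullary using (¬_; yes; no; contradiction)
open import Relation.Unary using (Pred; _∈_; _⊆_)

private
  variable
    A B : Set
    ℓ : Level

-- Prefixes and limits of words.

⊑-refl : {u : List A} → u ⊑ fin u
⊑-refl {u = u} = fin [] , ≋-reflexive (trans (◁-fin u []) (cong fin (++-identityʳ u)))

⊑-++ : (u v : List A) → u ⊑ fin (u ++ v)
⊑-++ u v = fin v , ≋-reflexive (◁-fin u v)

⊑-trans : {u v : List A} {w : Word A} → u ⊑ fin v → v ⊑ w → u ⊑ w
⊑-trans {u = u} u⊑v (x , p) with r , refl ← ⊑-fin {u = u} u⊑v =
  r ◁ x , ≋-trans (≋-reflexive (sym (◁-assoc u r x))) p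

⊑-[] : {w : Word A} → [] ⊑ w
⊑-[] {w = w} = w , ≋-refl

inf-∷ʷ : (s : ℕ → A) → inf s ≋ s 0 ∷ʷ inf (s ∘ suc)
inf-∷ʷ s zero    = refl
inf-∷ʷ s (suc n) = refl

applyUpTo-⊑ : (s : ℕ → A) (n : ℕ) → applyUpTo s n ⊑ inf s
applyUpTo-⊑ s zero    = inf s , ≋-refl
applyUpTo-⊑ s (suc n) with x , p ← applyUpTo-⊑ (s ∘ suc) n =
  x , ≋-trans (∷ʷ-cong (s 0) {applyUpTo (s ∘ suc) n ◁ x} {inf (s ∘ suc)} p)
              (≋-sym {v = inf s} {s 0 ∷ʷ inf (s ∘ suc)} (inf-∷ʷ s))

⊑-inf : (s : ℕ → A) (v : List A) → v ⊑ inf s → v ≡ applyUpTo s (length v)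
⊑-inf s []      _       = refl
⊑-inf s (a ∷ v) (x , p)
  with q , p′ ← ∷ʷ-injective {v = v ◁ x} {inf (s ∘ suc)}
                  (≋-trans {v = inf s} p (inf-∷ʷ s)) =
  cong₂ _∷_ q (⊑-inf (s ∘ suc) v (x , p′))

inf-LimitOf : (s : ℕ → A) → inf s LimitOf applyUpTo s
inf-LimitOf s = applyUpTo-⊑ s , λ v p →
  length v , subst (λ t → v ⊑ fin t) (⊑-inf s v p) ⊑-refl

LimitOf-cong : {w : Word A} {u v : ℕ → List A} → (∀ n → u n ≡ v n) →
  w LimitOf u → w LimitOf v
LimitOf-cong {w = w} eq (below , least) =
  (λ n → subst (_⊑ w) (eq n) (below n)) ,
  λ x p → let n , q = least x p in n , subst (λ t → x ⊑ fin t) (eq n) q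

-- Contiguous pieces of a sequence.

-- slice s i j consists of the letters s i, …, s (j − 1); it is empty if j ≤ i.
slice : (ℕ → A) → ℕ → ℕ → List A
slice s i j = drop i (applyUpTo s j)

slice-empty : (s : ℕ → A) {i j : ℕ} → j ≤ i → slice s i j ≡ []
slice-empty s {i} z≤n         = drop-[] i
slice-empty s     (s≤s j≤i) = slice-empty (s ∘ suc) j≤i

slice-++ : (s : ℕ → A) {i j l : ℕ} → i ≤ j → j ≤ l →
  slice s i j ++ slice s j l ≡ slice s i l
slice-++ s z≤n       z≤n       = refl
slice-++ s z≤n       (s≤s j≤l) = cong (s 0 ∷_) (slice-++ (s ∘ suc) z≤n j≤l)
slice-++ s (s≤s i≤j) (s≤s j≤l) = slice-++ (s ∘ suc) i≤j j≤l

slice-∷ : (s : ℕ → A) {i j : ℕ} → i < j → slice s i j ≡ s i ∷ slice s (suc i) j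
slice-∷ s {zero}  (s≤s _)   = refl
slice-∷ s {suc i} (s≤s i<j) = slice-∷ (s ∘ suc) i<j

slice-⊑ : (s : ℕ → A) (i : ℕ) {j l : ℕ} → j ≤ l → slice s i j ⊑ fin (slice s i l)
slice-⊑ s i {j} {l} j≤l with i ≤? j
... | yes i≤j = subst (λ t → slice s i j ⊑ fin t) (slice-++ s i≤j j≤l)
                  (⊑-++ (slice s i j) (slice s j l))
... | no  i≰j = subst (_⊑ fin (slice s i l)) (sym (slice-empty s (<⇒≤ (≰⇒> i≰j)))) ⊑-[]

slice-uncons : (s : ℕ → A) {i j : ℕ} {a : A} {u : List A} → a ∷ u ≡ slice s i j →
  i < j × a ≡ s i × u ≡ slice s (suc i) j
slice-uncons s {i} {j} eq with i <? j
... | yes i<j = i<j , ∷-injective (trans eq (slice-∷ s i<j))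
... | no  i≮j with () ← trans eq (slice-empty s (≮⇒≥ i≮j))

slice-shift : (s : ℕ → A) (j n : ℕ) → slice s j (j + n) ≡ applyUpTo (λ i → s (j + i)) n
slice-shift s zero    n = refl
slice-shift s (suc j) n = slice-shift (s ∘ suc) j n

slice-split : (s : ℕ → A) {i j : ℕ} (u : List A) {v : List A} → i ≤ j →
  u ++ v ≡ slice s i j →
  ∃[ m ] i ≤ m × m ≤ j × u ≡ slice s i m × v ≡ slice s m j
slice-split s {i} [] i≤j eq = i , ≤-refl , i≤j , sym (slice-empty s {i} ≤-refl) , eq
slice-split s {i} (a ∷ u) i≤j eq
  with i<j , a≡ , eq′ ← slice-uncons s eq
  with m , i<m , m≤j , u≡ , v≡ ← slice-split s u i<j eq′ =
  m , <⇒≤ i<m , m≤j , trans (cong₂ _∷_ a≡ u≡) (sym (slice-∷ s i<m)) , v≡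

-- Increasing positions and factorisations along them.

module _ {pos : ℕ → ℕ} (pos-step : ∀ n → pos n < pos (suc n)) where

  pos-0≤ : ∀ n → pos 0 ≤ pos n
  pos-0≤ zero    = ≤-refl
  pos-0≤ (suc n) = ≤-trans (pos-0≤ n) (<⇒≤ (pos-step n))

  pos-cofinal : ∀ n → n ≤ pos n
  pos-cofinal zero    = z≤n
  pos-cofinal (suc n) = ≤-<-trans (pos-cofinal n) (pos-step n)

  pos-< : ∀ {m n} → m < n → pos m < pos n
  pos-< {m} {suc n} (s≤s m≤n) with m≤n⇒m<n∨m≡n m≤n
  ... | inj₂ refl = pos-step n
  ... | inj₁ m<n  = <-trans (pos-< m<n) (pos-step n)

-- Two instances are used: the identity, for words over the alphabet, and `θ`, for runs whose `✓`
-- marks are erased.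
module Homomorphism (h : List A → List B)
  (h-[] : h [] ≡ []) (h-++ : ∀ u v → h (u ++ v) ≡ h u ++ h v) where

  h-slice-++ : ∀ s {i j l} → i ≤ j → j ≤ l →
    h (slice s i j) ++ h (slice s j l) ≡ h (slice s i l)
  h-slice-++ s i≤j j≤l = trans (sym (h-++ _ _)) (cong h (slice-++ s i≤j j≤l))

  h-slice-⊑ : ∀ s i {j l} → j ≤ l → h (slice s i j) ⊑ fin (h (slice s i l))
  h-slice-⊑ s i {j} {l} j≤l with r , eq ← ⊑-fin {u = slice s i j} (slice-⊑ s i j≤l) =
    subst (λ t → h (slice s i j) ⊑ fin t) (trans (sym (h-++ _ r)) (cong h eq)) (⊑-++ _ (h r))

  -- The remainder exists because `h (slice s i j)` is one of the approximations of `w`. Left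
  -- cancellation of this word turns approximations of `w` into those of the remainder.
  LimitOf-drop : ∀ s {i j w} → i ≤ j → w LimitOf (h ∘ slice s i) →
    ∃[ v ] w ≋ h (slice s i j) ◁ v × v LimitOf (h ∘ slice s j)
  LimitOf-drop s {i} {j} {w} i≤j (below , least) with v , pv≋w ← below j =
    v , ≋-sym pv≋w , below′ , least′
    where
    p = h (slice s i j)
    below′ : ∀ l → h (slice s j l) ⊑ v
    below′ l with j ≤? l
    ... | no j≰l = subst (_⊑ v) (sym (trans (cong h (slice-empty s (<⇒≤ (≰⇒> j≰l)))) h-[])) ⊑-[]
    ... | yes j≤l with x , q ← subst (_⊑ w) (sym (h-slice-++ s i≤j j≤l)) (below l) =
      ⊑-◁⁻¹ p (x , ≋-trans q (≋-sym pv≋w))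
    least′ : ∀ u → u ⊑ v → ∃[ l ] u ⊑ fin (h (slice s j l))
    least′ u u⊑v
      with x , q ← ⊑-◁ p u⊑v
      with l , r ← least (p ++ u) (x , ≋-trans q pv≋w) =
      -- The maximum with `j` makes the approximation reach past the cut.
      l ⊔ j , ⊑-◁⁻¹ p (subst (p ++ u ⊑_)
        (trans (cong fin (sym (h-slice-++ s i≤j (m≤n⊔m l j)))) (sym (◁-fin p _)))
        (⊑-trans {u = p ++ u} r (h-slice-⊑ s i (m≤m⊔n l j))))

  LimitOf-shift : ∀ s j {w} → w LimitOf (h ∘ slice s j) →
    w LimitOf (h ∘ applyUpTo (λ i → s (j + i)))
  LimitOf-shift s j {w} (below , least) =
    LimitOf-cong {w = w} (λ n → cong h (slice-shift s j n))
      ((λ n → below (j + n)) ,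
       λ u u⊑w → let n , p = least u u⊑w in n , ⊑-trans {u = u} p (h-slice-⊑ s j (m≤n+m n j)))

  module _ (s : ℕ → A) where

    concat-slices : ∀ pos → (∀ n → pos n < pos (suc n)) → ∀ n →
      concat (applyUpTo (λ m → h (slice s (pos m) (pos (suc m)))) n) ≡
      h (slice s (pos 0) (pos n))
    concat-slices pos pos-step zero = sym (trans (cong h (slice-empty s {pos 0} ≤-refl)) h-[])
    concat-slices pos pos-step (suc n) =
      trans (cong (h (slice s (pos 0) (pos 1)) ++_)
              (concat-slices (pos ∘ suc) (pos-step ∘ suc) n))
            (h-slice-++ s (<⇒≤ (pos-step 0)) (pos-0≤ (pos-step ∘ suc) n))

    -- Strict growth makes the positions cofinal, so the concatenated pieces exhaust `w`. This holds
    -- even where `h` erases pieces completely, in which case `w` may be finite.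
    slices-^ω : ∀ {pos} → (∀ n → pos n < pos (suc n)) → (L : Pred (List B) 0ℓ) →
      (∀ n → h (slice s (pos n) (pos (suc n))) ∈ L) →
      ∀ {w} → w LimitOf (h ∘ slice s (pos 0)) → w ∈ L ^ω
    slices-^ω {pos} pos-step L ∈L {w} (below , least) =
      (λ n → h (slice s (pos n) (pos (suc n)))) , ∈L ,
      (λ n → subst (_⊑ w) (sym (concat-slices pos pos-step n)) (below (pos n))) ,
      λ v v⊑w → let n , p = least v v⊑w in
        n , subst (λ t → v ⊑ fin t) (sym (concat-slices pos pos-step n))
              (⊑-trans {u = v} p (h-slice-⊑ s (pos 0) (pos-cofinal pos-step n)))

θ-++ : (u v : List (Maybe A)) → θ (u ++ v) ≡ θ u ++ θ v
θ-++ []           v = refl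
θ-++ (just a ∷ u) v = cong (a ∷_) (θ-++ u v)
θ-++ (✓ ∷ u)      v = θ-++ u v

-- Classical combinatorics: pigeonhole and Ramsey.

module Classical (em : ∀ {ℓ} → ExcludedMiddle ℓ) where

  ¬∀⇒∃¬ : ∀ {X : Set} {Q : X → Set ℓ} → ¬ (∀ x → Q x) → ∃[ x ] ¬ Q x
  ¬∀⇒∃¬ ¬∀ = em⇒dne em λ ¬∃ → ¬∀ λ x → em⇒dne em λ ¬q → ¬∃ (x , ¬q)

  -- If the first alternative fails at `m₀`, downward closure makes it fail at all larger bounds.
  -- Asking at `m ⊔ m₀` then yields one of the remaining alternatives, to which induction applies.
  pigeonhole : ∀ {n} (Q : Fin n → ℕ → Set) →
    (∀ i {l m} → l ≤ m → Q i m → Q i l) →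
    (∀ m → ∃[ i ] Q i m) → ∃[ i ] (∀ m → Q i m)
  pigeonhole {zero}  Q down total with () ← proj₁ (total 0)
  pigeonhole {suc n} Q down total with em {P = ∀ m → Q fzero m}
  ... | yes q = fzero , q
  ... | no ¬q with m₀ , ¬qm₀ ← ¬∀⇒∃¬ ¬q
              = let i , q = pigeonhole (Q ∘ fsuc) (down ∘ fsuc) total′ in fsuc i , q
    where
    total′ : ∀ m → ∃[ i ] Q (fsuc i) m
    total′ m with total (m ⊔ m₀)
    ... | fzero  , q = contradiction (down fzero (m≤n⊔m m m₀) q) ¬qm₀
    ... | fsuc i , q = i , down (fsuc i) (m≤m⊔n m m₀) q

  Unbounded : Pred ℕ 0ℓ → Set
  Unbounded S = ∀ m → ∃[ x ] m ≤ x × x ∈ S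

  monochromatic : ∀ {c} {S : Pred ℕ 0ℓ} → Unbounded S → (col : ℕ → Fin c) →
    ∃[ i ] Unbounded (λ x → x ∈ S × col x ≡ i)
  monochromatic {S = S} unb col = pigeonhole
    (λ i m → ∃[ x ] m ≤ x × x ∈ S × col x ≡ i)
    (λ { i l≤m (x , m≤x , q) → x , ≤-trans l≤m m≤x , q })
    (λ m → let x , m≤x , x∈S = unb m in col x , x , m≤x , x∈S , refl)

  enumerate : {S : Pred ℕ 0ℓ} → Unbounded S →
    Σ[ pos ∈ (ℕ → ℕ) ] (∀ n → pos n < pos (suc n)) × (∀ n → pos n ∈ S)
  enumerate {S} unb = proj₁ ∘ elem , (λ n → proj₁ (proj₂ (unb (suc (proj₁ (elem n)))))) ,
    proj₂ ∘ elem
    where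
    elem : ℕ → ∃ S
    elem zero    = let x , _ , x∈S = unb 0 in x , x∈S
    elem (suc n) = let x , _ , x∈S = unb (suc (proj₁ (elem n))) in x , x∈S

  -- Each stage is an unbounded set whose chosen point has a single colour with all members of the
  -- next stage. The colour of two points thus depends only on the earlier one, and a last
  -- pigeonhole makes it constant.
  ramsey : ∀ {c} (col : ℕ → ℕ → Fin c) →
    ∃[ i ] Σ[ pos ∈ (ℕ → ℕ) ] (∀ n → pos n < pos (suc n)) ×
      (∀ {m n} → m < n → col (pos m) (pos n) ≡ i)
  ramsey {c} col =
    let i , unb            = monochromatic {S = λ _ → ⊤} all-unbounded colour
        pos , step , pos∈S = enumerate unb
    in i , point ∘ stage ∘ pos , (λ n → proj₁ (proj₁ (later (step n)))) ,
       λ {m} m<n → trans (proj₂ (later (pos-< step m<n))) (proj₂ (pos∈S m))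
    where
    Stage : Set₁
    Stage = Σ[ S ∈ Pred ℕ 0ℓ ] Unbounded S

    all-unbounded : Unbounded (λ _ → ⊤)
    all-unbounded m = m , ≤-refl , tt

    point : Stage → ℕ
    point (S , unb) = proj₁ (unb 0)

    refine : (σ : Stage) →
      ∃[ i ] Unbounded (λ y → (point σ < y × y ∈ proj₁ σ) × col (point σ) y ≡ i)
    refine (S , unb) = monochromatic
      -- Only elements beyond the chosen point are kept, so that successive points increase.
      (λ m → let x , p , x∈S = unb (m ⊔ suc (proj₁ (unb 0))) in
             x , ≤-trans (m≤m⊔n m _) p , ≤-trans (m≤n⊔m m _) p , x∈S)
      (col (proj₁ (unb 0)))

    stage : ℕ → Stage
    stage zero    = (λ _ → ⊤) , all-unbounded
    stage (suc n) = _ , proj₂ (refine (stage n))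

    colour : ℕ → Fin c
    colour n = proj₁ (refine (stage n))

    stage-anti : ∀ {m n} → m ≤ n → proj₁ (stage n) ⊆ proj₁ (stage m)
    stage-anti {m} {n} m≤n with m≤n⇒m<n∨m≡n m≤n
    ... | inj₂ refl = id
    stage-anti {m} {suc n} m≤n | inj₁ (s≤s m≤n′) =
      λ { ((_ , y∈) , _) → stage-anti m≤n′ y∈ }

    later : ∀ {m n} → m < n → point (stage n) ∈ proj₁ (stage (suc m))
    later {m} {n} m<n = stage-anti m<n (proj₂ (proj₂ (proj₂ (stage n) 0)))

  -- Finite index of `∼` and extensiveness of the abstraction.

  module _ {k : ℕ} (𝔄 : ExtendedBüchiAutomaton k) where
    open ExtendedBüchiAutomaton 𝔄
    open Abstraction 𝔄

    bit : Set → Fin 2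
    bit X with em {P = X}
    ... | yes _ = fsuc fzero
    ... | no  _ = fzero

    bit-⇔ : ∀ {X Y} → bit X ≡ bit Y → X ⇔ Y
    bit-⇔ {X} {Y} eq with em {P = X} | em {P = Y}
    ... | yes x | yes y = mk⇔ (λ _ → y) (λ _ → x)
    ... | no ¬x | no ¬y = mk⇔ (λ x → contradiction x ¬x) (λ y → contradiction y ¬y)
    bit-⇔ () | yes _ | no _
    bit-⇔ () | no _  | yes _

    bits : List (Fin k) → Fin states → Fin states → Fin (2 * 2)
    bits w p q = combine (bit (p ⇝[ w ] q)) (bit (p ⇝ꟳ[ w ] q))

    -- The table of both reachability relations, with truth values decided classically, has finitely
    -- many values and serves as a colouring.
    signature : List (Fin k) → Fin (((2 * 2) ^ states) ^ states)
    signature w = funToFin λ p → funToFin (bits w p)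

    funToFin-injective : ∀ {m n} {f g : Fin m → Fin n} →
      funToFin f ≡ funToFin g → ∀ i → f i ≡ g i
    funToFin-injective {f = f} {g} eq i =
      trans (sym (finToFun-funToFin f i))
        (trans (cong (λ x → finToFun x i) eq) (finToFun-funToFin g i))

    signature-∼ : ∀ w u → signature w ≡ signature u → w ∼ u
    signature-∼ w u eq p q =
      let eq₁ , eq₂ = combine-injective
            (bit (p ⇝[ w ] q)) (bit (p ⇝ꟳ[ w ] q)) (bit (p ⇝[ u ] q)) (bit (p ⇝ꟳ[ u ] q))
            (funToFin-injective {f = bits w p} {bits u p}
              (funToFin-injective {f = funToFin ∘ bits w} {funToFin ∘ bits u} eq p) q)
      in bit-⇔ eq₁ , bit-⇔ eq₂

    -- Both slices must be nonempty: the empty word is alone in its class, which the signature need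
    -- not detect.
    slice-≈ : ∀ s {i j i′ j′} → i < j → i′ < j′ →
      signature (slice s i j) ≡ signature (slice s i′ j′) →
      ⟦ slice s i j ⟧ ≈ ⟦ slice s i′ j′ ⟧
    slice-≈ s i<j i′<j′ eq =
      subst₂ (λ w u → ⟦ w ⟧ ≈ ⟦ u ⟧) (sym (slice-∷ s i<j)) (sym (slice-∷ s i′<j′))
        (+≈+ (signature-∼ _ _ (subst₂ (λ w u → signature w ≡ signature u)
                            (slice-∷ s i<j) (slice-∷ s i′<j′) eq)))

    Homogeneous : (ℕ → Fin k) → Set
    Homogeneous s = Σ[ pos ∈ (ℕ → ℕ) ] (∀ n → pos n < pos (suc n)) ×
      (∀ {m n} → m < n → ⟦ slice s (pos m) (pos n) ⟧ ≈ ⟦ slice s (pos 0) (pos 1) ⟧)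

    homogeneous : ∀ s → Homogeneous s
    homogeneous s =
      let i , pos , inc , hom = ramsey (λ i j → signature (slice s i j)) in
      pos , inc , λ {m} {n} m<n →
        slice-≈ s {pos m} {pos n} (pos-< inc m<n) (inc 0) (trans (hom m<n) (sym (hom {0} {1} (s≤s z≤n))))

    factorise-fin : ∀ v → fin v ∈ ⟪ ⟦ v ⟧ , ⟦ [] ⟧ ⟫
    factorise-fin v =
      v , fin [] , ≈-refl , ((λ _ → []) , (λ _ → ε≈ε) , limit) ,
      ≋-reflexive (sym (trans (◁-fin v []) (cong fin (++-identityʳ v))))
      where
      empty : ∀ n → concat (applyUpTo (λ _ → []) n) ≡ ([] {A = Fin k})
      empty zero    = refl
      empty (suc n) = empty n
      limit : fin [] IsConcatOf (λ _ → [])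
      limit = (λ n → subst (_⊑ fin []) (sym (empty n)) ⊑-[]) , λ v p → 0 , p

    -- The first factor runs up to `pos 1`, so that it ends with a block of class `D`. Idempotence
    -- of `D` then yields `C ∙ D ≈ C`.
    factorise-inf : ∀ s → Homogeneous s → ∃[ p ] p ∈ 𝒞 × inf s ∈ ⟪ p ⟫
    factorise-inf s (pos , inc , hom) = (C , D) , (CD≈C , DD≈D) , slice s 0 (pos 1) , tail , ≈-refl ,
      slices-^ω s (inc ∘ suc) (lang D) (λ n → hom ≤-refl) tail-limit , inf≋
      where
      open Homomorphism {A = Fin k} id refl (λ _ _ → refl)
      C = ⟦ slice s 0 (pos 1) ⟧
      D = ⟦ slice s (pos 0) (pos 1) ⟧
      E = ⟦ slice s 0 (pos 0) ⟧
      drop-prefix = LimitOf-drop s {0} {pos 1} z≤n (inf-LimitOf s)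
      tail        = proj₁ drop-prefix
      inf≋        = proj₁ (proj₂ drop-prefix)
      tail-limit  = proj₂ (proj₂ drop-prefix)
      -- Two adjacent blocks form the block from `pos 0` to `pos 2`, which has the same class by
      -- homogeneity.
      DD≈D : D ∙ D ≈ D
      DD≈D = ≈-trans (∙-congˡ D (≈-sym (hom {1} {2} ≤-refl)))
        (≈-trans (≈-reflexive (cong ⟦_⟧ (slice-++ s (<⇒≤ (inc 0)) (<⇒≤ (inc 1)))))
          (hom {0} {2} (s≤s z≤n)))
      ED≈C : E ∙ D ≈ C
      ED≈C = ≈-reflexive (cong ⟦_⟧ (slice-++ s z≤n (<⇒≤ (inc 0))))
      CD≈C : C ∙ D ≈ C
      CD≈C = ≈-trans (∙-congʳ D (≈-sym ED≈C))
        (≈-trans (∙-assoc E D D) (≈-trans (∙-congˡ E DD≈D) ED≈C))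

    factorise : ∀ w → ∃[ p ] p ∈ 𝒞 × w ∈ ⟪ p ⟫
    factorise (fin v) = (⟦ v ⟧ , ⟦ [] ⟧) ,
      (≈-reflexive (cong ⟦_⟧ (++-identityʳ v)) , ε≈ε) , factorise-fin v
    factorise (inf s) = factorise-inf s (homogeneous s)

    -- A pair of `𝒞` whose language contains `w` lies in `𝔣 V`, and `w` itself witnesses that one
    -- application of `𝔣 ∘ 𝔤` keeps it.
    αω-extensive : ∀ V → V ⊆ γω (αω V)
    αω-extensive V {w} w∈V with p , p∈𝒞 , w∈p ← factorise w =
      p , (0 , p∈𝒞 , w , w∈p , p , (p∈𝒞 , w , w∈p , w∈V) , w∈p) , w∈p

-- Prefixes and divergence of runs.

module Traces {k : ℕ} (P : Program k) where
  open Program P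
  open Semantics P

  ⇓-prefix : ∀ {e w} u → u ⊑ fin w → e ⇓ w → e ⇑ u
  ⇓-prefix []      _   _ = ⇑-ε
  ⇓-prefix (x ∷ []) u⊑w ⇓-o with _ , refl ← ⊑-fin {u = [ x ]} u⊑w = ⇑-o
  ⇓-prefix (x ∷ y ∷ u) u⊑w ⇓-o with _ , () ← ⊑-fin {u = x ∷ y ∷ u} u⊑w
  ⇓-prefix (x ∷ u) u⊑w (⇓-call {w = w} d)
    with refl , u⊑w′ ← ∷ʷ-injective {v = u ◁ proj₁ u⊑w} {fin w} (proj₂ u⊑w) =
    ⇑-call (⇓-prefix u (proj₁ u⊑w , u⊑w′) d)
  ⇓-prefix (x ∷ u) u⊑w (⇓-?₁ d) = ⇑-?₁ (⇓-prefix (x ∷ u) u⊑w d)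
  ⇓-prefix (x ∷ u) u⊑w (⇓-?₂ d) = ⇑-?₂ (⇓-prefix (x ∷ u) u⊑w d)
  ⇓-prefix (x ∷ u) u⊑w (⇓-seq {w = w} {v} c d)
    with ⊑-split w {x ∷ u} {fin v} (subst (x ∷ u ⊑_) (sym (◁-fin w v)) u⊑w)
  ... | inj₁ u⊑w₁             = ⇑-seq₁ (⇓-prefix (x ∷ u) u⊑w₁ c)
  ... | inj₂ (u′ , eq , u′⊑v) = subst (_ ⇑_) (sym eq) (⇑-seq₂ c (⇓-prefix u′ u′⊑v d))

  -- Prefix closure carries facts about one long slice to all shorter ones, so the divergence
  -- arguments only have to look far enough.
  ⇑-prefix : ∀ {e w} u → u ⊑ fin w → e ⇑ w → e ⇑ u
  ⇑-prefix []      _   _ = ⇑-ε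
  ⇑-prefix (x ∷ u) u⊑w ⇑-ε with _ , () ← ⊑-fin {u = x ∷ u} u⊑w
  ⇑-prefix (x ∷ []) u⊑w ⇑-o with _ , refl ← ⊑-fin {u = [ x ]} u⊑w = ⇑-o
  ⇑-prefix (x ∷ y ∷ u) u⊑w ⇑-o with _ , () ← ⊑-fin {u = x ∷ y ∷ u} u⊑w
  ⇑-prefix (x ∷ u) u⊑w (⇑-call {w = w} d)
    with refl , u⊑w′ ← ∷ʷ-injective {v = u ◁ proj₁ u⊑w} {fin w} (proj₂ u⊑w) =
    ⇑-call (⇑-prefix u (proj₁ u⊑w , u⊑w′) d)
  ⇑-prefix (x ∷ u) u⊑w (⇑-seq₁ d) = ⇑-seq₁ (⇑-prefix (x ∷ u) u⊑w d)
  ⇑-prefix (x ∷ u) u⊑w (⇑-?₁ d)   = ⇑-?₁ (⇑-prefix (x ∷ u) u⊑w d)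
  ⇑-prefix (x ∷ u) u⊑w (⇑-?₂ d)   = ⇑-?₂ (⇑-prefix (x ∷ u) u⊑w d)
  ⇑-prefix (x ∷ u) u⊑w (⇑-seq₂ {w = w} {v} c d)
    with ⊑-split w {x ∷ u} {fin v} (subst (x ∷ u ⊑_) (sym (◁-fin w v)) u⊑w)
  ... | inj₁ u⊑w₁             = ⇑-seq₁ (⇓-prefix (x ∷ u) u⊑w₁ c)
  ... | inj₂ (u′ , eq , u′⊑v) = subst (_ ⇑_) (sym eq) (⇑-seq₂ c (⇑-prefix u′ u′⊑v d))

  ⇑-call⁻¹ : ∀ {f x w} → call f ⇑ x ∷ w → x ≡ ✓ × body f ⇑ w
  ⇑-call⁻¹ (⇑-call d) = refl , d

  module Divergence (em : ∀ {ℓ} → ExcludedMiddle ℓ) (s : ℕ → Maybe (Fin k)) where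
    open Classical em

    -- The run `s` stays fixed and the starting position moves, so that all subexpressions refer to
    -- the same infinite word. For `j ≤ i` the slice is empty and the condition trivial.
    Diverges : Expr → ℕ → Set
    Diverges e i = ∀ j → e ⇑ slice s i j

    ⇑-slice-≤ : ∀ {e i j l} → j ≤ l → e ⇑ slice s i l → e ⇑ slice s i j
    ⇑-slice-≤ {i = i} {j} j≤l = ⇑-prefix (slice s i j) (slice-⊑ s i j≤l)

    o-converges : ∀ {a i} → ¬ Diverges (o a) i
    o-converges {a} {i} d = two (subst (o a ⇑_)
      (trans (slice-∷ s {i} {suc (suc i)} (s≤s (n≤1+n i)))
        (cong (s i ∷_) (slice-∷ s {suc i} {suc (suc i)} ≤-refl))) (d (suc (suc i))))
      where
      two : ∀ {x y w} → ¬ (o a ⇑ x ∷ y ∷ w)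
      two ()

    call-diverges : ∀ {f i} → Diverges (call f) i → s i ≡ ✓ × Diverges (body f) (suc i)
    call-diverges {f} {i} d = proj₁ (unfold ≤-refl) , λ j → below j
      where
      unfold : ∀ {j} → i < j → s i ≡ ✓ × body f ⇑ slice s (suc i) j
      unfold {j} i<j = ⇑-call⁻¹ (subst (call f ⇑_) (slice-∷ s i<j) (d j))
      below : ∀ j → body f ⇑ slice s (suc i) j
      below j with i <? j
      ... | yes i<j = proj₂ (unfold i<j)
      ... | no  i≮j = subst (body f ⇑_) (sym (slice-empty s {suc i} (m≤n⇒m≤1+n (≮⇒≥ i≮j)))) ⇑-ε

    -- If `e₁` fails at `j₀`, it fails on every longer slice, which `e₂` must then perform.
    ¿-diverges : ∀ {e₁ e₂ i} → Diverges (e₁ ¿ e₂) i → Diverges e₁ i ⊎ Diverges e₂ i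
    ¿-diverges {e₁} {e₂} {i} d with em {P = Diverges e₁ i}
    ... | yes d₁ = inj₁ d₁
    ... | no ¬d₁ with j₀ , ¬d₁ ← ¬∀⇒∃¬ ¬d₁ =
      inj₂ λ j → second j (split (d (j ⊔ j₀)))
      where
      split : ∀ {w} → (e₁ ¿ e₂) ⇑ w → e₁ ⇑ w ⊎ e₂ ⇑ w
      split ⇑-ε      = inj₁ ⇑-ε
      split (⇑-?₁ x) = inj₁ x
      split (⇑-?₂ x) = inj₂ x
      second : ∀ j → e₁ ⇑ slice s i (j ⊔ j₀) ⊎ e₂ ⇑ slice s i (j ⊔ j₀) → e₂ ⇑ slice s i j
      second j (inj₁ x) = contradiction (⇑-slice-≤ {i = i} (m≤n⊔m j j₀) x) ¬d₁
      second j (inj₂ x) = ⇑-slice-≤ {i = i} (m≤m⊔n j j₀) x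

    -- If e₁ cannot perform the slice from i to j₀, then it terminates before
    -- j₀; of these finitely many positions, one serves all longer slices.
    ⨾-diverges : ∀ {e₁ e₂ i} → Diverges (e₁ ⨾ e₂) i →
      Diverges e₁ i ⊎ ∃[ m ] i ≤ m × e₁ ⇓ slice s i m × Diverges e₂ m
    ⨾-diverges {e₁} {e₂} {i} d with em {P = Diverges e₁ i}
    ... | yes d₁ = inj₁ d₁
    ... | no ¬d₁ with j₀ , ¬d₁ ← ¬∀⇒∃¬ ¬d₁ = inj₂
        (let x , splits = pigeonhole SplitsAt down total
             -- The termination of `e₁` does not depend on `j`, so any value serves.
             i≤m , c , _ = splits 0
         in toℕ x , i≤m , c , λ j → proj₂ (proj₂ (splits j)))
      where
      SplitsAt : Fin j₀ → ℕ → Set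
      SplitsAt x j = i ≤ toℕ x × e₁ ⇓ slice s i (toℕ x) × e₂ ⇑ slice s (toℕ x) j

      down : ∀ x {j l} → j ≤ l → SplitsAt x l → SplitsAt x j
      down x j≤l (i≤m , c , d₂) = i≤m , c , ⇑-slice-≤ {i = toℕ x} j≤l d₂

      split : ∀ {w} → (e₁ ⨾ e₂) ⇑ w →
        e₁ ⇑ w ⊎ ∃[ u ] ∃[ v ] u ++ v ≡ w × e₁ ⇓ u × e₂ ⇑ v
      split ⇑-ε          = inj₁ ⇑-ε
      split (⇑-seq₁ x)   = inj₁ x
      split (⇑-seq₂ c x) = inj₂ (_ , _ , refl , c , x)

      total : ∀ j → ∃[ x ] SplitsAt x j
      -- Reaching `j₀` rules out that `e₁` performs the whole slice, and reaching `i` is what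
      -- `slice-split` requires.
      total j with split (d ((j ⊔ j₀) ⊔ i))
      ... | inj₁ x = contradiction
        (⇑-slice-≤ {i = i} (≤-trans (m≤n⊔m j j₀) (m≤m⊔n (j ⊔ j₀) i)) x) ¬d₁
      ... | inj₂ (u , v , eq , c , x)
        with m , i≤m , _ , refl , refl ← slice-split s u (m≤n⊔m (j ⊔ j₀) i) eq
        with m <? j₀
      ... | no m≮j₀  = contradiction (⇓-prefix (slice s i j₀) (slice-⊑ s i (≮⇒≥ m≮j₀)) c) ¬d₁
      ... | yes m<j₀ = fromℕ< m<j₀ , subst
        (λ l → i ≤ l × e₁ ⇓ slice s i l × e₂ ⇑ slice s l j) (sym (toℕ-fromℕ< m<j₀))
        (i≤m , c , ⇑-slice-≤ {i = m} (≤-trans (m≤m⊔n j j₀) (m≤m⊔n (j ⊔ j₀) i)) x)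

-- Soundness of effects for terminating runs.

module Effects {k : ℕ} (P : Program k) (𝔄 : ExtendedBüchiAutomaton k) (𝔛 : Set) where
  open Program P
  open Semantics P
  open Abstraction 𝔄
  open BüchiTypes P 𝔄 𝔛

  ∈⇒γ⁎ : ∀ 𝒰 {w} → ⟦ w ⟧ ∈ ℳ⁎.set 𝒰 → w ∈ γ⁎ 𝒰
  ∈⇒γ⁎ 𝒰 w∈𝒰 = _ , w∈𝒰 , ≈-refl

  γω-· : ∀ 𝒰 𝒱 {u v w} → ⟦ u ⟧ ∈ ℳ⁎.set 𝒰 → v ∈ γω 𝒱 → w ≋ u ◁ v → w ∈ γω (𝒰 ·ω 𝒱)
  γω-· 𝒰 𝒱 {u} u∈𝒰 ((C , D) , CD∈𝒱 , c , z , c∈C , z∈D^ω , v≋) w≋ =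
    (⟦ u ⟧ ∙ C , D) , (⟦ u ⟧ , C , D , u∈𝒰 , CD∈𝒱 , ≈-refl , ≈-refl) ,
    u ++ c , z , ∙-congˡ ⟦ u ⟧ c∈C , z∈D^ω ,
    ≋-trans w≋ (≋-trans (◁-cong u v≋) (≋-reflexive (sym (◁-assoc u c z))))

  ·-ε : ∀ 𝒜 → ℳ⁎.set (𝒜 · ｛ε｝) ⊆ ℳ⁎.set 𝒜
  ·-ε 𝒜 {C} (A , _ , A∈𝒜 , ε≈ε , C≈) = ℳ⁎.resp 𝒜
    (≈-sym (≈-trans C≈ (≈-reflexive (cong ⟦_⟧ (++-identityʳ (𝒬.rep A)))))) A∈𝒜

  -- Bounding the length makes the environment extended by a recursive call
  -- correct before the body is analysed, so that derivations never have to be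
  -- weakened (𝔛 may not contain the fresh variables this would take).
  Correct : ℕ → List Binding → Set₁
  Correct N Δ = ∀ {f 𝒰 X} → (f &⟨ 𝒰 , X ⟩) ∈ˡ Δ →
    ∀ {w} → call f ⇓ w → length w ≤ N → ⟦ θ w ⟧ ∈ ℳ⁎.set 𝒰

  Correct-≤ : ∀ {M N Δ} → M ≤ N → Correct N Δ → Correct M Δ
  Correct-≤ M≤N ok b d ≤M = ok b d (≤-trans ≤M M≤N)

  mutual
    -- The `✓` opening a completed call uses up one unit of the bound. The body is therefore
    -- analysed at a smaller bound, for which `Correct-∷` supplies the extended environment.
    effect-sound : ∀ {N Δ e 𝒰 𝒱} → Correct N Δ → Δ ⊢ e & 𝒰 , 𝒱 →
      ∀ {w} → e ⇓ w → length w ≤ N → ⟦ θ w ⟧ ∈ ℳ⁎.set 𝒰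
    effect-sound ok ⊢-o ⇓-o _ = _ , ≈-refl , refl
    effect-sound ok (⊢-seq t₁ t₂) (⇓-seq {w = w} {u} d₁ d₂) ≤N
      rewrite length-++ w {u} | θ-++ w u =
      ⟦ θ w ⟧ , ⟦ θ u ⟧ ,
      effect-sound ok t₁ d₁ (≤-trans (m≤m+n _ _) ≤N) ,
      effect-sound ok t₂ d₂ (≤-trans (m≤n+m _ _) ≤N) , ≈-refl
    effect-sound ok (⊢-? t₁ t₂) (⇓-?₁ d) ≤N = inj₁ (effect-sound ok t₁ d ≤N)
    effect-sound ok (⊢-? t₁ t₂) (⇓-?₂ d) ≤N = inj₂ (effect-sound ok t₂ d ≤N)
    effect-sound ok (⊢-var b) d ≤N = ok b d ≤N
    effect-sound ok (⊢-call _ _ t) (⇓-call d) (s≤s ≤N) =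
      effect-sound (Correct-∷ (Correct-≤ (n≤1+n _) ok) t) t d ≤N
    effect-sound ok (⊢-≐ (𝒰⊆ , _) _ t) d ≤N = 𝒰⊆ (effect-sound ok t d ≤N)

    Correct-∷ : ∀ {N Δ f 𝒰 X 𝒱} → Correct N Δ →
      (f &⟨ 𝒰 , X ⟩) ∷ Δ ⊢ body f & 𝒰 , 𝒱 → Correct N ((f &⟨ 𝒰 , X ⟩) ∷ Δ)
    Correct-∷ ok t (there b) d ≤N = ok b d ≤N
    Correct-∷ {suc N} ok t (here refl) (⇓-call d) (s≤s ≤N) =
      effect-sound (Correct-∷ (Correct-≤ (n≤1+n _) ok) t) t d ≤N

  -- Induction on the bound; at `0` no case arises, since a completed call contains at least its own
  -- `✓`.
  Justified⇒Correct : ∀ {Δ} → Justified Δ → ∀ N → Correct N Δ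
  Justified⇒Correct just-Δ (suc N) b (⇓-call d) (s≤s ≤N) =
    let _ , _ , _ , t = just-Δ b in effect-sound (Justified⇒Correct just-Δ N) t d ≤N

  -- Pending calls in infinite runs.

  module Escape (em : ∀ {ℓ} → ExcludedMiddle ℓ) (s : ℕ → Maybe (Fin k)) where
    open Classical em
    open Traces P
    open Divergence em s
    open Homomorphism {A = Maybe (Fin k)} θ refl θ-++

    suffix : ℕ → ℕ → List (Fin k)
    suffix i = θ ∘ slice s i

    -- A pending call is recorded by its position in the run, without reference to `η`, so that
    -- rounds of a recursion can be chained along `s`.
    Escapes : List Binding → VExpr → ℕ → Set₁
    Escapes Δ 𝒱 i =
      (∀ w → w LimitOf suffix i → w ∈ γω (VExpr.const 𝒱)) ⊎
      (∃[ f ] ∃[ 𝒰 ] ∃[ Y ] ∃[ j ] (f &⟨ 𝒰 , Y ⟩) ∈ˡ Δ × i ≤ j ×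
         ⟦ suffix i j ⟧ ∈ ℳ⁎.set (VExpr.coeff 𝒱 Y) × Diverges (call f) j)

    Escapes-mono : ∀ {Δ} 𝒱 𝒱′ {i} →
      (∀ Y → ℳ⁎.set (VExpr.coeff 𝒱 Y) ⊆ ℳ⁎.set (VExpr.coeff 𝒱′ Y)) →
      ℳω.set (VExpr.const 𝒱) ⊆ ℳω.set (VExpr.const 𝒱′) →
      Escapes Δ 𝒱 i → Escapes Δ 𝒱′ i
    Escapes-mono _ _ coeff⊆ const⊆ (inj₁ x) =
      inj₁ λ w lim → let p , p∈ , w∈p = x w lim in p , const⊆ p∈ , w∈p
    Escapes-mono _ _ coeff⊆ const⊆ (inj₂ (f , 𝒰 , Y , j , b , i≤j , x , d)) =
      inj₂ (f , 𝒰 , Y , j , b , i≤j , coeff⊆ Y x , d)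

    Escapes-∪ˡ : ∀ {Δ} 𝒱 𝒱′ {i} → Escapes Δ 𝒱 i → Escapes Δ (𝒱 ∪ᵛ 𝒱′) i
    Escapes-∪ˡ 𝒱 𝒱′ = Escapes-mono 𝒱 (𝒱 ∪ᵛ 𝒱′) (λ _ → inj₁) inj₁

    Escapes-∪ʳ : ∀ {Δ} 𝒱 𝒱′ {i} → Escapes Δ 𝒱′ i → Escapes Δ (𝒱 ∪ᵛ 𝒱′) i
    Escapes-∪ʳ 𝒱 𝒱′ = Escapes-mono 𝒱′ (𝒱 ∪ᵛ 𝒱′) (λ _ → inj₂) inj₂

    Escapes-· : ∀ {Δ} 𝒜 𝒱 {i j} → i ≤ j → ⟦ suffix i j ⟧ ∈ ℳ⁎.set 𝒜 →
      Escapes Δ 𝒱 j → Escapes Δ (𝒜 ·ᵛ 𝒱) i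
    Escapes-· 𝒜 𝒱 i≤j u∈𝒜 (inj₁ x) = inj₁ λ w lim →
      let v , w≋ , lim′ = LimitOf-drop s i≤j lim
      in γω-· 𝒜 (VExpr.const 𝒱) u∈𝒜 (x v lim′) w≋
    Escapes-· 𝒜 𝒱 i≤j u∈𝒜 (inj₂ (f , 𝒰 , Y , l , b , j≤l , x , d)) =
      inj₂ (f , 𝒰 , Y , l , b , ≤-trans i≤j j≤l ,
            (_ , _ , u∈𝒜 , x , ≈-reflexive (cong ⟦_⟧ (sym (h-slice-++ s i≤j j≤l)))) , d)

    module _ {Δ : List Binding} {f : Fin procs} {𝒜 : ℳ⁎} {𝒱 : VExpr}
      (unfold : ∀ j → Diverges (call f) j → Escapes Δ 𝒱 j ⊎
        ∃[ l ] j < l × ⟦ suffix j l ⟧ ∈ ℳ⁎.set 𝒜 × Diverges (call f) l) where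

      Exits : ℕ → Set₁
      Exits j = ∃[ l ] j ≤ l × suffix j l ∈ γ⁎ 𝒜 ⋆ × Escapes Δ 𝒱 l

      Loops : Set₁
      Loops = ∃[ j ] Diverges (call f) j × ¬ Exits j

      -- An immediate escape would be an exit after zero rounds, and an exit from the next call,
      -- prefixed by the current round, would be an exit from `j`. Hence the absence of exits passes
      -- on to the next call.
      continue : ((j , _) : Loops) → Σ[ (l , _) ∈ Loops ] j < l × suffix j l ∈ γ⁎ 𝒜
      continue (j , d , ¬exit) with unfold j d
      ... | inj₁ esc = contradiction
        (j , ≤-refl , ([] , [] , sym (cong θ (slice-empty s {j} ≤-refl))) , esc) ¬exit
      ... | inj₂ (l , j<l , u∈𝒜 , d′) = (l , d′ , ¬exit′) , j<l , ∈⇒γ⁎ 𝒜 u∈𝒜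
        where
        ¬exit′ : ¬ Exits l
        ¬exit′ (m , l≤m , (us , us∈ , eq) , esc) = ¬exit
          (m , ≤-trans (<⇒≤ j<l) l≤m ,
           (suffix j l ∷ us , ∈⇒γ⁎ 𝒜 u∈𝒜 ∷ us∈ ,
            trans (cong (suffix j l ++_) eq) (h-slice-++ s (<⇒≤ j<l) l≤m)) , esc)

      -- Either finitely many rounds lead to an exit, or `continue` can be iterated forever and its
      -- increasing positions cut the whole run into words of `γ⁎ 𝒜`.
      Escapes-loop : ∀ i → Diverges (call f) i →
        Escapes Δ (𝒜 ⋆ᵃ ·ᵛ 𝒱 ∪ᵛ constᵛ (𝒜 ^ωᵃ)) i
      Escapes-loop i d with em {P = Exits i}
      ... | yes (l , i≤l , u∈⋆ , esc) =
        Escapes-∪ˡ (𝒜 ⋆ᵃ ·ᵛ 𝒱) (constᵛ (𝒜 ^ωᵃ))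
          (Escapes-· (𝒜 ⋆ᵃ) 𝒱 i≤l (_ , ≈-refl , u∈⋆) esc)
      ... | no ¬exit = inj₁ λ w lim →
        let p , p∈ , w∈p = αω-extensive 𝔄 (γ⁎ 𝒜 ^ω) (slices-^ω s
              (λ n → proj₁ (proj₂ (continue (loop n)))) (γ⁎ 𝒜)
              (λ n → proj₂ (proj₂ (continue (loop n)))) lim)
        in p , inj₂ p∈ , w∈p
        where
        loop : ℕ → Loops
        loop zero    = i , d , ¬exit
        loop (suc n) = proj₁ (continue (loop n))

    -- Induction on the derivation for all positions at once: in the call rule, the hypothesis for
    -- the body is applied anew at each pending call of `f`.
    escapes : ∀ {Δ e 𝒰 𝒱} → (∀ N → Correct N Δ) → Δ ⊢ e & 𝒰 , 𝒱 →
      ∀ i → Diverges e i → Escapes Δ 𝒱 i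
    escapes ok ⊢-o i d = ⊥-elim (o-converges {i = i} d)
    escapes ok (⊢-seq {𝒰₁ = 𝒰₁} {𝒱₁ = 𝒱₁} {𝒱₂} t₁ t₂) i d with ⨾-diverges {i = i} d
    ... | inj₁ d₁ = Escapes-∪ˡ 𝒱₁ (𝒰₁ ·ᵛ 𝒱₂) (escapes ok t₁ i d₁)
    ... | inj₂ (j , i≤j , c , d₂) = Escapes-∪ʳ 𝒱₁ (𝒰₁ ·ᵛ 𝒱₂)
      (Escapes-· 𝒰₁ 𝒱₂ i≤j (effect-sound (ok _) t₁ c ≤-refl) (escapes ok t₂ j d₂))
    escapes ok (⊢-? {𝒱₁ = 𝒱₁} {𝒱₂} t₁ t₂) i d with ¿-diverges {i = i} d
    ... | inj₁ d₁ = Escapes-∪ˡ 𝒱₁ 𝒱₂ (escapes ok t₁ i d₁)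
    ... | inj₂ d₂ = Escapes-∪ʳ 𝒱₁ 𝒱₂ (escapes ok t₂ i d₂)
    escapes ok (⊢-var b) i d = inj₂ (_ , _ , _ , i , b , ≤-refl ,
      (refl , ≈-reflexive (cong ⟦_⟧ (sym (cong θ (slice-empty s {i} ≤-refl))))) , d)
    escapes {Δ} ok (⊢-call {f} {𝒰} {X} {𝒜} {𝒱} env omits t) =
      Escapes-loop {𝒜 = 𝒜} {𝒱} unfold
      where
      -- Entering the body moves the position, which gives the strict `j < l` below, but leaves the
      -- trace unchanged because `θ` erases the `✓`.
      ✓-skip : ∀ {j} → s j ≡ ✓ → ∀ l → suffix (suc j) l ≡ suffix j l
      ✓-skip {j} sj≡✓ l with j <? l
      ... | yes j<l = sym (cong θ (trans (slice-∷ s j<l) (cong (_∷ slice s (suc j) l) sj≡✓)))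
      ... | no  j≮l = cong θ (trans (slice-empty s {suc j} (m≤n⇒m≤1+n (≮⇒≥ j≮l)))
                                    (sym (slice-empty s (≮⇒≥ j≮l))))

      unfold : ∀ j → Diverges (call f) j → Escapes Δ 𝒱 j ⊎
        ∃[ l ] j < l × ⟦ suffix j l ⟧ ∈ ℳ⁎.set 𝒜 × Diverges (call f) l
      unfold j d
        with sj≡✓ , d′ ← call-diverges d
        with escapes (λ N → Correct-∷ (ok N) t) t (suc j) d′
      ... | inj₁ x = inj₁ (inj₁ λ w lim → drop-∅
              (x w (LimitOf-cong {w = w} (λ l → sym (✓-skip sj≡✓ l)) lim)))
        where
        -- The constant part of `𝒜 ·ᵛ var X` is a product with `∅ω`, hence empty.
        drop-∅ : ∀ {w} → w ∈ γω (𝒜 ·ω ∅ω ∪ω VExpr.const 𝒱) → w ∈ γω (VExpr.const 𝒱)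
        drop-∅ (p , inj₂ p∈ , w∈p) = p , p∈ , w∈p
      ... | inj₂ (g , _ , Y , l , b , j<l , x , d″) = classify b x
        where
        repeat : Diverges (call f) l →
          ⟦ suffix (suc j) l ⟧ ∈ ℳ⁎.set (𝒜 · VExpr.coeff (var X) X) →
          ∃[ l ] j < l × ⟦ suffix j l ⟧ ∈ ℳ⁎.set 𝒜 × Diverges (call f) l
        repeat d (A , E , A∈𝒜 , (_ , ε≈E) , eq) = l , j<l ,
          ·-ε 𝒜 (A , E , A∈𝒜 , ε≈E ,
                  ≈-trans (≈-reflexive (cong ⟦_⟧ (sym (✓-skip sj≡✓ l)))) eq) , d

        classify : ∀ {𝒰′} → (g &⟨ 𝒰′ , Y ⟩) ∈ˡ (f &⟨ 𝒰 , X ⟩) ∷ Δ →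
          ⟦ suffix (suc j) l ⟧ ∈ ℳ⁎.set (VExpr.coeff (𝒜 ·ᵛ var X ∪ᵛ 𝒱) Y) →
          Escapes Δ 𝒱 j ⊎ ∃[ l ] j < l × ⟦ suffix j l ⟧ ∈ ℳ⁎.set 𝒜 × Diverges (call f) l
        classify (here refl) (inj₁ x) = inj₂ (repeat d″ x)
        classify (here refl) (inj₂ x) = ⊥-elim (proj₁ omits x)
        -- `Δ` may already bind `X`; the environment condition then makes that binding one for `f`,
        -- so the call counts as a further round.
        classify (there b) (inj₁ x@(_ , _ , _ , (refl , _) , _)) = inj₂ (repeat
          (subst (λ g → Diverges (call g) l)
            (sym (proj₁ (env (here refl) (there b) refl))) d″) x)
        classify (there b) (inj₂ x) = inj₁ (inj₂ (g , _ , Y , l , b , <⇒≤ j<l ,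
          subst (λ u → ⟦ u ⟧ ∈ ℳ⁎.set (VExpr.coeff 𝒱 Y)) (✓-skip sj≡✓ l) x , d″))
    escapes ok (⊢-≐ {𝒱 = 𝒱} {𝒱′} _ (coeff≐ , const≐) t) i d =
      Escapes-mono 𝒱 𝒱′ (λ Y → proj₁ (coeff≐ Y)) (proj₁ const≐) (escapes ok t i d)

theorem13 : (∀ {ℓ} → ExcludedMiddle ℓ) →
    {k : ℕ} (P : Program k) (𝔄 : ExtendedBüchiAutomaton k) (𝔛 : Set) →
    let open Semantics P
        open Abstraction 𝔄
        open BüchiTypes P 𝔄 𝔛
    in
    (Δ : List Binding) → IsEnvironment Δ →
    (η : 𝔛 → ℳω) → η ⊨ Δ →
    (e : Expr) (𝒰 : ℳ⁎) (𝒱 : VExpr) → Δ ⊢ e & 𝒰 , 𝒱 →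
    ((w : List (Fin k)) → e ↓ w → w ∈ γ⁎ 𝒰) ×
    ((w : Word (Fin k)) → e ↑ w → w ∈ γω (𝒱 ⟨ η ⟩))
theorem13 em {k} P 𝔄 𝔛 Δ _ η (justified , η-sound) e 𝒰 𝒱 t = finite , infinite
  where
  open Semantics P
  open Abstraction 𝔄
  open BüchiTypes P 𝔄 𝔛
  open Effects P 𝔄 𝔛
  open Homomorphism {A = Maybe (Fin k)} θ refl θ-++

  correct : ∀ N → Correct N Δ
  correct = Justified⇒Correct justified

  finite : ∀ w → e ↓ w → w ∈ γ⁎ 𝒰
  finite _ (w , d , refl) = ∈⇒γ⁎ 𝒰 (effect-sound (correct _) t d ≤-refl)

  infinite : ∀ w → e ↑ w → w ∈ γω (𝒱 ⟨ η ⟩)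
  infinite w (s , d , lim) with Escape.escapes em s correct t 0 d
  ... | inj₁ x = let p , p∈ , w∈p = x w lim in p , inj₂ p∈ , w∈p
  ... | inj₂ (g , _ , Y , j , b , _ , u∈ , d′) =
    let v , w≋ , lim′ = LimitOf-drop s {j = j} z≤n lim
        -- `η` enters only here: the run shifted by `j` is an infinite run of the pending call to
        -- `g`.
        v∈ = η-sound b v
               ((λ i → s (j + i)) ,
                (λ n → subst (call g ⇑_) (slice-shift s j n) (d′ (j + n))) ,
                LimitOf-shift s j lim′)
        p , p∈ , w∈p = γω-· (VExpr.coeff 𝒱 Y) (η Y) u∈ v∈ w≋
    in p , inj₁ (Y , p∈) , w∈p
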